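{- Let $n\ge 8$ or $n=3$, and let $f:Sym_n\to\mathbb{R}$ be an $(n-2)$-eigenfunction of the Star graph $S_n$. Then $|Supp(f)|\ge 2(n-1)!$. Moreover, $|Supp(f)|=2(n-1)!$ if and only if $f=c\cdot\tilde f$ for some real non-zero constant $c$ and some $\tilde f\in\mathcal{F}$.
   Context: For $n\ge 3$, the Star graph $S_n$ is the Cayley graph on the symmetric group $Sym_n$ with generating set $\{(1\,i): i\in\{2,\ldots,n\}\}$; permutations $x,y$ are adjacent iff $xy^{ -1}$ is one of these transpositions. For an eigenvalue $\lambda$ of the adjacency matrix of a graph with vertex set $V$, a $\lambda$-eigenfunction is a function $f:V\to\mathbb{R}$, $f\not\equiv 0$, with $\lambda f(x)=\sum_{y\in N(x)}f(y)$ for all $x\in V$, where $N(x)$ is the set of neighbours of $x$. The support is $Supp(f)=\{x\in V: f(x)\neq 0\}$. For $u\in\{1,\ldots,n\}$ and $v,w\in\{2,\ldots,n\}$ with $v\ne w$, define $f_u^{v,w}:Sym_n\to\mathbb{R}$ by $f_u^{v,w}(\pi)=1$ if $\pi(v)=u$, $f_u^{v,w}(\pi)=-1$ if $\pi(w)=u$, and $0$ otherwise. Let $\mathcal{F}=\{f_u^{v,w}: u\in\{1,\ldots,n\},\ v,w\in\{2,\ldots,n\},\ v\ne w\}$. -}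

module Defs where

open import Level using (Level; suc; zero)
open import Data.Nat as ℕ using (ℕ)
open import Data.Fin as Fin using (Fin)
open import Data.Fin.Permutation using (Permutation′; _⟨$⟩ʳ_; _∘ₚ_; transpose)
open import Data.Fin.Permutation as Perm using (_≈_)
open import Data.List using (List; length)
open import Data.List.Relation.Unary.All using (All)
open import Data.List.Relation.Unary.Any using (Any)
open import Data.List.Relation.Unary.AllPairs using (AllPairs)
open import Data.Product using (Σ; ∃; _×_; _,_)
open import Relation.Binary using (IsTotalOrder)
open import Relation.Binary.Definitions using (DecidableEquality)
open import Relation.Binary.PropositionalEquality using (_≡_)
open import Relation.Nullary using (¬_; yes; no)
open import Algebra.Structures using (IsCommutativeRing)
open import Function.Bundles using (_⇔_)

-- An axiomatic model of the real numbers: a (Dedekind-)complete ordered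
-- field (with equality decidable, as holds classically for ℝ).

record RealField : Set₁ where
  infixl 7 _*_
  infixl 6 _+_
  infix  4 _≤_
  field
    ℝ      : Set
    0r 1r  : ℝ
    _+_ _*_ : ℝ → ℝ → ℝ
    -_     : ℝ → ℝ
    _≤_    : ℝ → ℝ → Set
    isCommutativeRing : IsCommutativeRing _≡_ _+_ _*_ -_ 0r 1r
    0≢1     : ¬ (0r ≡ 1r)
    inverse : ∀ x → ¬ (x ≡ 0r) → Σ ℝ (λ y → x * y ≡ 1r)
    isTotalOrder : IsTotalOrder _≡_ _≤_
    +-monoˡ-≤ : ∀ z {x y} → x ≤ y → x + z ≤ y + z
    *-nonneg  : ∀ {x y} → 0r ≤ x → 0r ≤ y → 0r ≤ x * y
    complete : (P : ℝ → Set) → ∃ P → ∃ (λ b → ∀ x → P x → x ≤ b) →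
               ∃ (λ s → (∀ x → P x → x ≤ s) ×
                        (∀ b → (∀ x → P x → x ≤ b) → s ≤ b))
    _≟_ : DecidableEquality ℝ

-- Star graph S_n on Sym_n, n = suc m.  Points {1,…,n} are Fin n with
-- 1 ↦ Fin.zero.  Permutations are compared pointwise (Perm._≈_).

Sym : ℕ → Set
Sym n = Permutation′ n

-- (t ∘ₚ π) ⟨$⟩ʳ k = π ⟨$⟩ʳ (t ⟨$⟩ʳ k), i.e. π composed with (1 i) on the right.
-- The neighbours of π are π∘(1 i), i = 2,…,n (i = Fin.suc j, j : Fin m).
starNeighbour : ∀ {m} → Sym (ℕ.suc m) → Fin m → Sym (ℕ.suc m)
starNeighbour π j = transpose Fin.zero (Fin.suc j) ∘ₚ π

module _ (R : RealField) where
  open RealField R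

  sumFin : ∀ {k} → (Fin k → ℝ) → ℝ
  sumFin {ℕ.zero}  g = 0r
  sumFin {ℕ.suc k} g = g Fin.zero + sumFin (λ i → g (Fin.suc i))

  fromℕ : ℕ → ℝ
  fromℕ ℕ.zero    = 0r
  fromℕ (ℕ.suc k) = 1r + fromℕ k

  Respects : ∀ {n} → (Sym n → ℝ) → Set
  Respects f = ∀ {π σ} → π ≈ σ → f π ≡ f σ

  IsEigenfunction : ∀ m → ℝ → (Sym (ℕ.suc m) → ℝ) → Set
  IsEigenfunction m λ′ f =
    (∃ λ π → ¬ (f π ≡ 0r)) ×
    (∀ π → λ′ * f π ≡ sumFin (λ j → f (starNeighbour π j)))

  InSupp : ∀ {n} → (Sym n → ℝ) → Sym n → Set
  InSupp f π = ¬ (f π ≡ 0r)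

  SuppAtLeast : ∀ {n} → (Sym n → ℝ) → ℕ → Set
  SuppAtLeast {n} f k = Σ (List (Sym n)) λ L →
    length L ≡ k × AllPairs (λ π σ → ¬ (π ≈ σ)) L × All (InSupp f) L

  SuppSize : ∀ {n} → (Sym n → ℝ) → ℕ → Set
  SuppSize {n} f k = Σ (List (Sym n)) λ L →
    length L ≡ k × AllPairs (λ π σ → ¬ (π ≈ σ)) L ×
    (∀ π → InSupp f π ⇔ Any (π ≈_) L)

  fF : ∀ {n} → Fin n → Fin n → Fin n → Sym n → ℝ
  fF u v w π with π ⟨$⟩ʳ v Fin.≟ u
  ... | yes _ = 1r
  ... | no  _ with π ⟨$⟩ʳ w Fin.≟ u
  ...   | yes _ = - 1r
  ...   | no  _ = 0r

  IsMultipleOfF : ∀ m → (Sym (ℕ.suc m) → ℝ) → Set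
  IsMultipleOfF m f = Σ ℝ λ c → ¬ (c ≡ 0r) ×
    Σ (Fin (ℕ.suc m)) λ u → Σ (Fin (ℕ.suc m)) λ v → Σ (Fin (ℕ.suc m)) λ w →
      ¬ (v ≡ Fin.zero) × ¬ (w ≡ Fin.zero) × ¬ (v ≡ w) ×
      (∀ π → f π ≡ c * fF u v w π)

{-# OPTIONS --safe #-}
-- Let n = m + 1, t j = (0 j), T f (π) = ∑ⱼ f (π (0 j)) and suppose T f = (n - 2) f.  Write F for f translated by
-- t j and put h = T F - (n - 2) F.  If Y denotes the star centred at j on the positions {1,…,m} (with its trivial
-- term included), then Y F = m F - f and Y commutes with T, so Y h = m h; since Y has m terms, the maximum
-- principle on each coset π(0) = u makes h(π) = ηⱼ(π(0)) a function of π(0) alone.  Then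
-- q = n (f - F) + ηⱼ(π(j)) - ηⱼ(π(0)) + ∑ ηⱼ satisfies Y q = n q, hence q = 0 by the maximum principle again, and
-- summing over j gives n f(π) = - ∑ⱼ ηⱼ(π(j)): f is given by a matrix with zero row 0, zero row sums and zero
-- column sums.
--
-- If d = (row v) - (row w) differs at π(v) and π(w), then π or π (v w) lies in the support, so the support has at
-- least (n - 2)! · #{(a, b) : d a ≠ d b} / 2 elements.  This beats 2 (n - 1)! as soon as d takes its most frequent
-- value at most n - 3 times.  If d is constant up to exactly two columns, a second pair of different rows,
-- disjoint from {v, w}, contributes enough further permutations when n ≥ 8; if there is none, the matrix is
-- essentially determined by one row.  If every d is constant up to at most one column, the whole matrix lives in a
-- single column u, f(π) depends only on the position of u, and at least two positions have a nonzero value.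
module Submission where

open import Defs

module Counting where

  open import Data.Bool using (true; false; if_then_else_)
  open import Data.Fin as Fin using (Fin; zero; suc; combine; remQuot)
  open import Data.Fin.Permutation using (_≈_; _⟨$⟩ʳ_; _⟨$⟩ˡ_; _∘ₚ_; transpose; permutation; insert; remove; flip; inverseˡ; inverseʳ; insert-remove; remove-insert; insert-punchIn; punchIn-permute; Permutation)
  import Data.Fin.Permutation as Perm
  import Data.Fin.Permutation.Components as PC
  open import Data.Fin.Properties using (remQuot-combine; combine-remQuot; punchIn-injective; any?)
  open import Data.List using (List; length; map; filter; tabulate; allFin)
  open import Data.List.Properties using (length-map)
  open import Data.List.Membership.Propositional using (_∈_)
  open import Data.List.Membership.Propositional.Properties using (∈-map⁻; ∈-filter⁺; ∈-filter⁻; ∈-allFin)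
  open import Data.List.Membership.Propositional.Properties.WithK using (unique∧set⇒bag)
  open import Data.List.Relation.Binary.BagAndSetEquality using (∼bag⇒↭)
  open import Data.List.Relation.Binary.Permutation.Propositional.Properties using (↭-length)
  open import Data.List.Relation.Unary.All as All using (All)
  import Data.List.Relation.Unary.All.Properties as All
  open import Data.List.Relation.Unary.AllPairs as AllPairs using (AllPairs)
  import Data.List.Relation.Unary.AllPairs.Properties as AllPairs
  open import Data.List.Relation.Unary.Any as Any using (Any)
  import Data.List.Relation.Unary.Any.Properties as Any
  open import Data.List.Relation.Unary.Unique.Propositional using (Unique)
  import Data.List.Relation.Unary.Unique.Propositional.Properties as Unique
  open import Data.Nat using (ℕ; zero; suc; _+_; _*_; _≤_; _<_; z≤n; s≤s; _!)
  open import Data.Nat.Properties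
  open import Data.Product using (∃; _×_; _,_; proj₁; proj₂)
  open import Function using (_∘_; _⇔_; mk⇔; Equivalence)
  open import Relation.Binary.Definitions using (DecidableEquality)
  open import Relation.Binary.PropositionalEquality
  open import Relation.Nullary
  open import Relation.Nullary.Decidable using (decidable-stable)
  open import Relation.Unary using (Pred; Decidable)
  open import Algebra.Properties.Semiring.Sum +-*-semiring using (sum; sum-cong-≗; ∑-distrib-+; ∑-comm; sum-permute; *-distribˡ-sum; *-distribʳ-sum)

  private variable
    n k : ℕ
    P Q : Set

  -- Indicators and finite sums of natural numbers.

  𝟙 : Dec P → ℕ
  𝟙 d = if does d then 1 else 0

  𝟙-yes : (d : Dec P) → P → 𝟙 d ≡ 1
  𝟙-yes (yes _) _ = refl
  𝟙-yes (no ¬p) p = contradiction p ¬p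

  𝟙-no : (d : Dec P) → ¬ P → 𝟙 d ≡ 0
  𝟙-no (yes p) ¬p = contradiction p ¬p
  𝟙-no (no _)  _  = refl

  𝟙≤1 : (d : Dec P) → 𝟙 d ≤ 1
  𝟙≤1 (yes _) = s≤s z≤n
  𝟙≤1 (no _)  = z≤n

  𝟙-mono : (d : Dec P) (e : Dec Q) → (P → Q) → 𝟙 d ≤ 𝟙 e
  𝟙-mono (yes p) e f = ≤-reflexive (sym (𝟙-yes e (f p)))
  𝟙-mono (no _)  e f = z≤n

  𝟙-cong : (d : Dec P) (e : Dec Q) → (P → Q) → (Q → P) → 𝟙 d ≡ 𝟙 e
  𝟙-cong d e f g = ≤-antisym (𝟙-mono d e f) (𝟙-mono e d g)

  𝟙-¬ : (d : Dec P) → 𝟙 d + 𝟙 (¬? d) ≡ 1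
  𝟙-¬ (yes _) = refl
  𝟙-¬ (no _)  = refl

  sum-mono-≤ : {f g : Fin n → ℕ} → (∀ i → f i ≤ g i) → sum f ≤ sum g
  sum-mono-≤ {zero}  h = z≤n
  sum-mono-≤ {suc n} h = +-mono-≤ (h zero) (sum-mono-≤ (h ∘ suc))

  ∑-const : ∀ n c → sum {n} (λ _ → c) ≡ n * c
  ∑-const zero    c = refl
  ∑-const (suc n) c = cong (c +_) (∑-const n c)

  sum-δ : (i : Fin n) (c : ℕ) → sum (λ j → 𝟙 (i Fin.≟ j) * c) ≡ c
  sum-δ {suc n} zero c = begin
    c + 0 + sum {n} (λ _ → 0) ≡⟨ cong₂ _+_ (+-identityʳ c) (trans (∑-const n 0) (*-zeroʳ n)) ⟩
    c + 0                     ≡⟨ +-identityʳ c ⟩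
    c                         ∎
    where open ≡-Reasoning
  sum-δ (suc i) c = sum-δ i c

  sum-𝟙≟ : (i : Fin n) → sum (λ j → 𝟙 (i Fin.≟ j)) ≡ 1
  sum-𝟙≟ i = trans (sum-cong-≗ λ j → sym (*-identityʳ (𝟙 (i Fin.≟ j)))) (sum-δ i 1)

  two≤sum : (f : Fin n → ℕ) {i j : Fin n} → i ≢ j → f i + f j ≤ sum f
  two≤sum f {i} {j} i≢j = begin
    f i + f j                                                       ≡⟨ cong₂ _+_ (sum-δ i _) (sum-δ j _) ⟨
    sum (λ l → 𝟙 (i Fin.≟ l) * f i) + sum (λ l → 𝟙 (j Fin.≟ l) * f j) ≡⟨ ∑-distrib-+ (λ l → 𝟙 (i Fin.≟ l) * f i) _ ⟨
    sum (λ l → 𝟙 (i Fin.≟ l) * f i + 𝟙 (j Fin.≟ l) * f j)           ≤⟨ sum-mono-≤ bound ⟩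
    sum f                                                           ∎
    where
    open ≤-Reasoning
    bound : ∀ l → 𝟙 (i Fin.≟ l) * f i + 𝟙 (j Fin.≟ l) * f j ≤ f l
    bound l with i Fin.≟ l | j Fin.≟ l
    ... | yes refl | yes refl = contradiction refl i≢j
    ... | yes refl | no _     = ≤-reflexive (trans (+-identityʳ _) (+-identityʳ _))
    ... | no _     | yes refl = ≤-reflexive (+-identityʳ _)
    ... | no _     | no _     = z≤n

  sum<⇒∃0 : (f : Fin n → ℕ) → sum f < n → ∃ λ i → f i ≡ 0
  sum<⇒∃0 {n} f lt with any? (λ i → f i ≟ 0)
  ... | yes r = r
  ... | no ¬r = contradiction lt (≤⇒≯ (begin
    n                    ≡⟨ *-identityʳ n ⟨
    n * 1                ≡⟨ ∑-const n 1 ⟨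
    sum {n} (λ _ → 1)    ≤⟨ sum-mono-≤ (λ i → n≢0⇒n>0 λ e → ¬r (i , e)) ⟩
    sum f                ∎))
    where open ≤-Reasoning

  -- The three indicators have total sum 3, less than `n`, so some index is missed by all of them.
  -- The arguments may coincide; repeating one serves to avoid only two indices.
  fresh₃ : 3 < n → (x y z : Fin n) → ∃ λ b → b ≢ x × b ≢ y × b ≢ z
  fresh₃ {n} 3<n x y z = b , apart x z≤₁ , apart y z≤₂ , apart z z≤₃
    where
    f : Fin n → ℕ
    f i = 𝟙 (x Fin.≟ i) + (𝟙 (y Fin.≟ i) + 𝟙 (z Fin.≟ i))
    sum-f : sum f ≡ 3
    sum-f = trans (∑-distrib-+ (λ i → 𝟙 (x Fin.≟ i)) _) (cong₂ _+_ (sum-𝟙≟ x)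
      (trans (∑-distrib-+ (λ i → 𝟙 (y Fin.≟ i)) _) (cong₂ _+_ (sum-𝟙≟ y) (sum-𝟙≟ z))))
    found : ∃ λ i → f i ≡ 0
    found = sum<⇒∃0 f (subst (_< n) (sym sum-f) 3<n)
    b = proj₁ found
    z≤₁ : 𝟙 (x Fin.≟ b) ≡ 0
    z≤₁ = m+n≡0⇒m≡0 _ (proj₂ found)
    z≤₂₃ : 𝟙 (y Fin.≟ b) + 𝟙 (z Fin.≟ b) ≡ 0
    z≤₂₃ = m+n≡0⇒n≡0 (𝟙 (x Fin.≟ b)) (proj₂ found)
    z≤₂ : 𝟙 (y Fin.≟ b) ≡ 0
    z≤₂ = m+n≡0⇒m≡0 _ z≤₂₃
    z≤₃ : 𝟙 (z Fin.≟ b) ≡ 0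
    z≤₃ = m+n≡0⇒n≡0 (𝟙 (y Fin.≟ b)) z≤₂₃
    apart : ∀ x → 𝟙 (x Fin.≟ b) ≡ 0 → b ≢ x
    apart x e b≡x with () ← trans (sym e) (𝟙-yes (x Fin.≟ b) (sym b≡x))

  -- Transpositions acting on positions.

  transpose-fst : (i j : Fin n) → PC.transpose i j i ≡ j
  transpose-fst i j with i Fin.≟ i
  ... | yes _  = refl
  ... | no i≢i = contradiction refl i≢i

  transpose-snd : (i j : Fin n) → PC.transpose i j j ≡ i
  transpose-snd i j with j Fin.≟ i
  ... | yes j≡i = j≡i
  ... | no _ with j Fin.≟ j
  ...   | yes _  = refl
  ...   | no j≢j = contradiction refl j≢j

  transpose-other : {i j l : Fin n} → l ≢ i → l ≢ j → PC.transpose i j l ≡ l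
  transpose-other {i = i} {j} {l} l≢i l≢j with l Fin.≟ i
  ... | yes l≡i = contradiction l≡i l≢i
  ... | no _ with l Fin.≟ j
  ...   | yes l≡j = contradiction l≡j l≢j
  ...   | no _    = refl

  perm-injective : (π : Sym n) {i j : Fin n} → π ⟨$⟩ʳ i ≡ π ⟨$⟩ʳ j → i ≡ j
  perm-injective π e = trans (sym (inverseˡ π)) (trans (cong (π ⟨$⟩ˡ_) e) (inverseˡ π))

  transpose-conj : (π : Sym n) (i j : Fin n) →
    transpose i j ∘ₚ π ≈ π ∘ₚ transpose (π ⟨$⟩ʳ i) (π ⟨$⟩ʳ j)
  transpose-conj π i j l = by-cases (l Fin.≟ i) (l Fin.≟ j)
    where
    by-cases : Dec (l ≡ i) → Dec (l ≡ j) → π ⟨$⟩ʳ PC.transpose i j l ≡ PC.transpose (π ⟨$⟩ʳ i) (π ⟨$⟩ʳ j) (π ⟨$⟩ʳ l)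
    by-cases (yes refl) _          = trans (cong (π ⟨$⟩ʳ_) (transpose-fst l j)) (sym (transpose-fst (π ⟨$⟩ʳ l) (π ⟨$⟩ʳ j)))
    by-cases (no _)     (yes refl) = trans (cong (π ⟨$⟩ʳ_) (transpose-snd i l)) (sym (transpose-snd (π ⟨$⟩ʳ i) (π ⟨$⟩ʳ l)))
    by-cases (no l≢i)   (no l≢j)   = trans (cong (π ⟨$⟩ʳ_) (transpose-other l≢i l≢j))
      (sym (transpose-other (l≢i ∘ perm-injective π) (l≢j ∘ perm-injective π)))

  -- Enumeration of the symmetric group.

  enum : ∀ n → Fin (n !) → Sym n
  enum zero    _ = Perm.id
  enum (suc n) k = let j , l = remQuot {suc n} (n !) k in insert zero j (enum n l)

  -- With `enum` this is the factorial number system: the leading digit is the image of `zero`, the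
  -- remaining digits encode the permutation left after deleting it.
  index : Sym n → Fin (n !)
  index {zero}  _ = zero
  index {suc n} π = combine (π ⟨$⟩ʳ zero) (index (remove zero π))

  remove₀-cong : {π σ : Sym (suc n)} → π ≈ σ → remove zero π ≈ remove zero σ
  remove₀-cong {π = π} {σ} e i = punchIn-injective (π ⟨$⟩ʳ zero) _ _ (begin
    Fin.punchIn (π ⟨$⟩ʳ zero) (remove zero π ⟨$⟩ʳ i) ≡⟨ punchIn-permute π zero i ⟨
    π ⟨$⟩ʳ suc i                                     ≡⟨ e (suc i) ⟩
    σ ⟨$⟩ʳ suc i                                     ≡⟨ punchIn-permute σ zero i ⟩
    Fin.punchIn (σ ⟨$⟩ʳ zero) (remove zero σ ⟨$⟩ʳ i) ≡⟨ cong (λ j → Fin.punchIn j (remove zero σ ⟨$⟩ʳ i)) (e zero) ⟨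
    Fin.punchIn (π ⟨$⟩ʳ zero) (remove zero σ ⟨$⟩ʳ i) ∎)
    where open ≡-Reasoning

  insert₀-cong : {i j : Fin (suc n)} {π σ : Sym n} → i ≡ j → π ≈ σ → insert zero i π ≈ insert zero j σ
  insert₀-cong refl e zero    = refl
  insert₀-cong {i = i} {π = π} {σ} refl e (suc l) = trans (insert-punchIn zero i π l)
    (trans (cong (Fin.punchIn i) (e l)) (sym (insert-punchIn zero i σ l)))

  index-cong : {π σ : Sym n} → π ≈ σ → index π ≡ index σ
  index-cong {zero}  e = refl
  index-cong {suc n} {π} {σ} e = cong₂ combine (e zero) (index-cong (remove₀-cong {π = π} {σ} e))

  index-enum : ∀ n (k : Fin (n !)) → index (enum n k) ≡ k
  index-enum zero    zero = refl
  index-enum (suc n) k = let j , l = remQuot {suc n} (n !) k in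
    trans (cong (combine j) (trans (index-cong (remove-insert zero j (enum n l))) (index-enum n l)))
          (combine-remQuot {suc n} (n !) k)

  enum-index : (π : Sym n) → enum n (index π) ≈ π
  enum-index {zero}  π ()
  enum-index {suc n} π = λ i → trans (step i) (insert-remove zero π i)
    where
    eq : remQuot {suc n} (n !) (index π) ≡ (π ⟨$⟩ʳ zero , index (remove zero π))
    eq = remQuot-combine (π ⟨$⟩ʳ zero) (index (remove zero π))
    step : enum (suc n) (index π) ≈ insert zero (π ⟨$⟩ʳ zero) (remove zero π)
    step = insert₀-cong (cong proj₁ eq) λ i →
      trans (cong (λ p → enum n (proj₂ p) ⟨$⟩ʳ i) eq) (enum-index (remove zero π) i)

  -- Sums over the symmetric group.

  Resp : {A : Set} → (Sym n → A) → Set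
  Resp w = ∀ π σ → π ≈ σ → w π ≡ w σ

  ∑ₚ : (Sym n → ℕ) → ℕ
  ∑ₚ {n} w = sum (λ k → w (enum n k))

  ∑ₚ-mono : {w u : Sym n → ℕ} → (∀ π → w π ≤ u π) → ∑ₚ w ≤ ∑ₚ u
  ∑ₚ-mono h = sum-mono-≤ (λ k → h (enum _ k))

  ∑ₚ-cong : {w u : Sym n → ℕ} → (∀ π → w π ≡ u π) → ∑ₚ w ≡ ∑ₚ u
  ∑ₚ-cong h = sum-cong-≗ (λ k → h (enum _ k))

  ∑ₚ-+ : (w u : Sym n → ℕ) → ∑ₚ (λ π → w π + u π) ≡ ∑ₚ w + ∑ₚ u
  ∑ₚ-+ {n} w u = ∑-distrib-+ (w ∘ enum n) (u ∘ enum n)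

  ∑ₚ-const : ∀ n c → ∑ₚ {n} (λ _ → c) ≡ n ! * c
  ∑ₚ-const n c = ∑-const (n !) c

  sum-∑ₚ : (w : Fin k → Sym n → ℕ) → sum (λ i → ∑ₚ (w i)) ≡ ∑ₚ (λ π → sum (λ i → w i π))
  sum-∑ₚ {n = n} w = ∑-comm (λ i → w i ∘ enum n)

  -- Translation by `τ` permutes the indices, and translation by `flip τ` undoes it. `Resp w` enters
  -- because enumerating `τ ∘ₚ π` again recovers it only up to `≈`.
  ∑ₚ-translate : (τ : Sym n) {w : Sym n → ℕ} → Resp w → ∑ₚ (λ π → w (τ ∘ₚ π)) ≡ ∑ₚ w
  ∑ₚ-translate {n} τ {w} resp = begin
    sum (λ k → w (τ ∘ₚ enum n k))              ≡⟨ sum-cong-≗ (λ k → sym (resp _ _ (enum-index (τ ∘ₚ enum n k)))) ⟩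
    sum (λ k → w (enum n (shift τ k)))         ≡⟨ sum-permute (w ∘ enum n) shiftₚ ⟨
    sum (w ∘ enum n)                           ∎
    where
    open ≡-Reasoning
    shift : Sym n → Fin (n !) → Fin (n !)
    shift σ k = index (σ ∘ₚ enum n k)
    shift-inverse : (σ ρ : Sym n) → (∀ i → ρ ⟨$⟩ʳ (σ ⟨$⟩ʳ i) ≡ i) → ∀ k → shift σ (shift ρ k) ≡ k
    shift-inverse σ ρ inv k = trans
      (index-cong λ i → trans (enum-index (ρ ∘ₚ enum n k) (σ ⟨$⟩ʳ i)) (cong (enum n k ⟨$⟩ʳ_) (inv i)))
      (index-enum n k)
    shiftₚ : Permutation (n !) (n !)
    shiftₚ = permutation (shift τ) (shift (flip τ))
      (shift-inverse τ (flip τ) (λ _ → inverseˡ τ))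
      (shift-inverse (flip τ) τ (λ _ → inverseʳ τ))

  sum-perm : (π : Sym n) (G : Fin n → ℕ) → sum (λ v → G (π ⟨$⟩ʳ v)) ≡ sum G
  sum-perm π G = sym (sum-permute G π)

  -- By translation the left side is the same for every position. Added over all `suc n` positions
  -- it gives `sum G` for each permutation, and the factor `suc n` cancels.
  one-position : (v : Fin (suc n)) (G : Fin (suc n) → ℕ) →
    ∑ₚ (λ π → G (π ⟨$⟩ʳ v)) ≡ n ! * sum G
  one-position {n} v G = *-cancelˡ-≡ _ _ (suc n) (begin
    suc n * X                                        ≡⟨ ∑-const (suc n) X ⟨
    sum {suc n} (λ _ → X)                            ≡⟨ sum-cong-≗ same ⟩
    sum (λ z → ∑ₚ (λ π → G (π ⟨$⟩ʳ z)))              ≡⟨ sum-∑ₚ (λ z π → G (π ⟨$⟩ʳ z)) ⟩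
    ∑ₚ (λ π → sum (λ z → G (π ⟨$⟩ʳ z)))              ≡⟨ ∑ₚ-cong (λ π → sum-perm π G) ⟩
    ∑ₚ {suc n} (λ π → sum G)                         ≡⟨ ∑ₚ-const (suc n) (sum G) ⟩
    suc n * n ! * sum G                              ≡⟨ *-assoc (suc n) (n !) (sum G) ⟩
    suc n * (n ! * sum G)                            ∎)
    where
    open ≡-Reasoning
    X = ∑ₚ (λ π → G (π ⟨$⟩ʳ v))
    same : ∀ z → X ≡ ∑ₚ (λ π → G (π ⟨$⟩ʳ z))
    same z = trans (∑ₚ-cong λ π → cong (λ i → G (π ⟨$⟩ʳ i)) (sym (transpose-snd v z)))
                   (∑ₚ-translate (transpose v z) {λ π → G (π ⟨$⟩ʳ z)} (λ _ _ e → cong G (e z)))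

  -- The second position is averaged out while `v` stays fixed; what remains depends on `π ⟨$⟩ʳ v`
  -- only and is counted by `one-position`.
  two-positions : {v w : Fin (2 + n)} → v ≢ w → (F : Fin (2 + n) → Fin (2 + n) → ℕ) → (∀ a → F a a ≡ 0) →
    ∑ₚ (λ π → F (π ⟨$⟩ʳ v) (π ⟨$⟩ʳ w)) ≡ n ! * sum (λ a → sum (F a))
  two-positions {n} {v} {w} v≢w F F-diag = *-cancelˡ-≡ _ _ (suc n) (+-cancelˡ-≡ X _ _ (begin
    (2 + n) * X                                      ≡⟨ ∑-const (2 + n) X ⟨
    -- The index `z = v` contributes nothing to `sum u`, since `F` vanishes on the diagonal. One
    -- copy of `X` makes up for it and is cancelled at the end.
    sum {2 + n} (λ _ → X)                            ≡⟨ sum-cong-≗ same ⟩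
    sum (λ z → 𝟙 (v Fin.≟ z) * X + u z)              ≡⟨ ∑-distrib-+ (λ z → 𝟙 (v Fin.≟ z) * X) u ⟩
    sum (λ z → 𝟙 (v Fin.≟ z) * X) + sum u            ≡⟨ cong₂ _+_ (sum-δ v X) sum-u ⟩
    X + suc n ! * T                                  ≡⟨ cong (X +_) (*-assoc (suc n) (n !) T) ⟩
    X + suc n * (n ! * T)                            ∎))
    where
    open ≡-Reasoning
    X = ∑ₚ (λ π → F (π ⟨$⟩ʳ v) (π ⟨$⟩ʳ w))
    T = sum (λ a → sum (F a))
    u : Fin (2 + n) → ℕ
    u z = ∑ₚ (λ π → F (π ⟨$⟩ʳ v) (π ⟨$⟩ʳ z))
    sum-u : sum u ≡ suc n ! * T
    sum-u = begin
      sum u                                                       ≡⟨ sum-∑ₚ (λ z π → F (π ⟨$⟩ʳ v) (π ⟨$⟩ʳ z)) ⟩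
      ∑ₚ (λ π → sum (λ z → F (π ⟨$⟩ʳ v) (π ⟨$⟩ʳ z)))              ≡⟨ ∑ₚ-cong (λ π → sum-perm π (F (π ⟨$⟩ʳ v))) ⟩
      ∑ₚ (λ π → sum (F (π ⟨$⟩ʳ v)))                               ≡⟨ one-position v (λ a → sum (F a)) ⟩
      suc n ! * T                                                 ∎
    same : ∀ z → X ≡ 𝟙 (v Fin.≟ z) * X + u z
    same z with v Fin.≟ z
    ... | yes refl = sym (trans (cong₂ _+_ (*-identityˡ X) (trans (∑ₚ-cong (λ π → F-diag (π ⟨$⟩ʳ v)))
                       (trans (∑ₚ-const (2 + n) 0) (*-zeroʳ ((2 + n) !))))) (+-identityʳ X))
    ... | no v≢z = trans
      (∑ₚ-cong λ π → cong₂ (λ i j → F (π ⟨$⟩ʳ i) (π ⟨$⟩ʳ j)) (sym (transpose-other v≢w v≢z)) (sym (transpose-snd w z)))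
      (∑ₚ-translate (transpose w z) {λ π → F (π ⟨$⟩ʳ v) (π ⟨$⟩ʳ z)} (λ _ _ e → cong₂ F (e v) (e z)))

  -- The n - 2 positions z other than x and y contribute equally, and add up to at most sum G for each permutation.
  third-position : {x y v : Fin n} → v ≢ x → v ≢ y → (F : Fin n → Fin n → ℕ) (G : Fin n → ℕ) →
    let X = ∑ₚ (λ π → F (π ⟨$⟩ʳ x) (π ⟨$⟩ʳ y) * G (π ⟨$⟩ʳ v)) in
    n * X ≤ X + (X + ∑ₚ (λ π → F (π ⟨$⟩ʳ x) (π ⟨$⟩ʳ y)) * sum G)
  third-position {n} {x} {y} {v} v≢x v≢y F G = begin
    n * X                                                             ≡⟨ ∑-const n X ⟨
    sum {n} (λ _ → X)                                                 ≤⟨ sum-mono-≤ same ⟩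
    sum (λ z → 𝟙 (x Fin.≟ z) * X + (𝟙 (y Fin.≟ z) * X + u z))         ≡⟨ ∑-distrib-+ (λ z → 𝟙 (x Fin.≟ z) * X) _ ⟩
    sum (λ z → 𝟙 (x Fin.≟ z) * X) + sum (λ z → 𝟙 (y Fin.≟ z) * X + u z) ≡⟨ cong₂ _+_ (sum-δ x X) (∑-distrib-+ (λ z → 𝟙 (y Fin.≟ z) * X) u) ⟩
    X + (sum (λ z → 𝟙 (y Fin.≟ z) * X) + sum u)                       ≡⟨ cong (X +_) (cong₂ _+_ (sum-δ y X) sum-u) ⟩
    X + (X + ∑ₚ C * sum G)                                            ∎
    where
    open ≤-Reasoning
    C : Sym n → ℕ
    C π = F (π ⟨$⟩ʳ x) (π ⟨$⟩ʳ y)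
    X = ∑ₚ (λ π → C π * G (π ⟨$⟩ʳ v))
    u : Fin n → ℕ
    u z = ∑ₚ (λ π → C π * G (π ⟨$⟩ʳ z))
    sum-u : sum u ≡ ∑ₚ C * sum G
    sum-u = trans (sum-∑ₚ (λ z π → C π * G (π ⟨$⟩ʳ z)))
      (trans (∑ₚ-cong λ π → trans (sym (*-distribˡ-sum (C π) (λ z → G (π ⟨$⟩ʳ z)))) (cong (C π *_) (sum-perm π G)))
             (sym (*-distribʳ-sum (sum G) (C ∘ enum n))))
    same : ∀ z → X ≤ 𝟙 (x Fin.≟ z) * X + (𝟙 (y Fin.≟ z) * X + u z)
    same z with x Fin.≟ z | y Fin.≟ z
    ... | yes _ | _     = ≤-trans (≤-reflexive (sym (*-identityˡ X))) (m≤m+n (1 * X) _)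
    ... | no _  | yes _ = ≤-trans (≤-reflexive (sym (*-identityˡ X))) (m≤m+n (1 * X) _)
    ... | no x≢z | no y≢z = ≤-reflexive (trans
      (∑ₚ-cong λ π → cong₂ _*_
        (cong₂ (λ i j → F (π ⟨$⟩ʳ i) (π ⟨$⟩ʳ j)) (sym (transpose-other (v≢x ∘ sym) x≢z)) (sym (transpose-other (v≢y ∘ sym) y≢z)))
        (cong (λ i → G (π ⟨$⟩ʳ i)) (sym (transpose-snd v z))))
      (∑ₚ-translate (transpose v z) {λ π → C π * G (π ⟨$⟩ʳ z)} (λ _ _ e → cong₂ _*_ (cong₂ F (e x) (e y)) (cong G (e z)))))

  -- Cardinality of a decidable set of permutations.

  length-filter-tabulate : {A : Set} {P : Pred A _} (P? : Decidable P) (f : Fin n → A) →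
    length (filter P? (tabulate f)) ≡ sum (λ i → 𝟙 (P? (f i)))
  length-filter-tabulate {zero}  P? f = refl
  length-filter-tabulate {suc n} P? f with does (P? (f zero))
  ... | true  = cong suc (length-filter-tabulate P? (f ∘ suc))
  ... | false = length-filter-tabulate P? (f ∘ suc)

  module Cardinality {n} {S : Sym n → Set} (S? : Decidable S) (S-resp : ∀ π σ → π ≈ σ → S π → S σ) where

    card : ℕ
    card = ∑ₚ (λ π → 𝟙 (S? π))

    indices : List (Fin (n !))
    indices = filter (S? ∘ enum n) (allFin (n !))

    elements : List (Sym n)
    elements = map (enum n) indices

    length-indices : length indices ≡ card
    length-indices = length-filter-tabulate (S? ∘ enum n) (λ i → i)

    length-elements : length elements ≡ card
    length-elements = trans (length-map (enum n) indices) length-indices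

    indices-unique : Unique indices
    indices-unique = Unique.filter⁺ (S? ∘ enum n) (Unique.allFin⁺ (n !))

    elements-distinct : AllPairs (λ π σ → ¬ (π ≈ σ)) elements
    elements-distinct = AllPairs.map⁺ (AllPairs.map
      (λ {i} {j} i≢j e → i≢j (trans (sym (index-enum n i)) (trans (index-cong e) (index-enum n j)))) indices-unique)

    elements-satisfy : All S elements
    elements-satisfy = All.map⁺ (All.all-filter (S? ∘ enum n) (allFin (n !)))

    ∈-indices : ∀ {π} → S π → index π ∈ indices
    ∈-indices {π} s = ∈-filter⁺ (S? ∘ enum n) (∈-allFin (index π)) (S-resp π _ (sym ∘ enum-index π) s)

    ∈-elements : ∀ π → S π ⇔ Any (π ≈_) elements
    ∈-elements π = mk⇔
      (λ s → Any.map⁺ (Any.map (λ { refl → sym ∘ enum-index π }) (∈-indices s)))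
      (λ a → let s , e = All.lookupAny elements-satisfy a in S-resp _ π (sym ∘ e) s)

    -- Taking indices turns `L` into a duplicate-free list with the same members as `indices`, and
    -- two such lists are rearrangements of each other.
    card-unique : (L : List (Sym n)) → AllPairs (λ π σ → ¬ (π ≈ σ)) L → (∀ π → S π ⇔ Any (π ≈_) L) → length L ≡ card
    card-unique L distinct complete = begin
      length L                 ≡⟨ length-map index L ⟨
      length (map index L)     ≡⟨ ↭-length (∼bag⇒↭ (unique∧set⇒bag unique indices-unique (mk⇔ to from))) ⟩
      length indices           ≡⟨ length-indices ⟩
      card                     ∎
      where
      open ≡-Reasoning
      index-injective : ∀ {π σ} → index π ≡ index σ → π ≈ σ
      index-injective {π} {σ} e i = trans (sym (enum-index π i))
        (trans (cong (λ k → Data.Fin.Permutation._⟨$⟩ʳ_ (enum n k) i) e) (enum-index σ i))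
      unique : Unique (map index L)
      unique = AllPairs.map⁺ (AllPairs.map (λ ne e → ne (index-injective e)) distinct)
      to : ∀ {k} → k ∈ map index L → k ∈ indices
      to k∈ with π , π∈L , refl ← ∈-map⁻ index k∈ =
        ∈-indices (Equivalence.from (complete π) (Any.map (λ { refl _ → refl }) π∈L))
      from : ∀ {k} → k ∈ indices → k ∈ map index L
      from {k} k∈ = Any.map⁺ (Any.map (λ e → trans (sym (index-enum n k)) (index-cong e))
        (Equivalence.to (complete (enum n k)) (proj₂ (∈-filter⁻ (S? ∘ enum n) {xs = allFin (n !)} k∈))))

  -- Ordered pairs of arguments on which a function takes different values.

  module Unequal {X : Set} (_≟ˣ_ : DecidableEquality X) (d : Fin n → X) where

    differ : Fin n → Fin n → ℕ
    differ a b = 𝟙 (¬? (d a ≟ˣ d b))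

    differ-diag : ∀ a → differ a a ≡ 0
    differ-diag a = 𝟙-no (¬? (d a ≟ˣ d a)) (contradiction refl)

    differ≤1 : ∀ a b → differ a b ≤ 1
    differ≤1 a b = 𝟙≤1 (¬? (d a ≟ˣ d b))

    differ-sym : ∀ a b → differ a b ≡ differ b a
    differ-sym a b = 𝟙-cong (¬? (d a ≟ˣ d b)) (¬? (d b ≟ˣ d a)) (_∘ sym) (_∘ sym)

    differ≢0 : ∀ {a b} → differ a b ≢ 0 → d a ≢ d b
    differ≢0 {a} {b} ne e = ne (𝟙-no (¬? (d a ≟ˣ d b)) (contradiction e))

    differing : Fin n → ℕ
    differing a = sum (differ a)

    agreeing : Fin n → ℕ
    agreeing a = sum (λ b → 𝟙 (d a ≟ˣ d b))

    pairs : ℕ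
    pairs = sum differing

    agreeing+differing : ∀ a → agreeing a + differing a ≡ n
    agreeing+differing a = begin
      agreeing a + differing a                      ≡⟨ ∑-distrib-+ (λ b → 𝟙 (d a ≟ˣ d b)) (differ a) ⟨
      sum (λ b → 𝟙 (d a ≟ˣ d b) + differ a b)       ≡⟨ sum-cong-≗ (λ b → 𝟙-¬ (d a ≟ˣ d b)) ⟩
      sum {n} (λ _ → 1)                             ≡⟨ ∑-const n 1 ⟩
      n * 1                                         ≡⟨ *-identityʳ n ⟩
      n                                             ∎
      where open ≡-Reasoning

    -- These are the ordered pairs, in both directions, between the level set of `a` and its
    -- complement.
    pairs-≥ : ∀ a → agreeing a * differing a + differing a * agreeing a ≤ pairs
    pairs-≥ a = begin
      agreeing a * differing a + differing a * agreeing a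
        ≡⟨ cong₂ _+_ (*-distribʳ-sum (differing a) (λ b → 𝟙 (d a ≟ˣ d b))) (*-distribʳ-sum (agreeing a) (differ a)) ⟩
      sum (λ c → 𝟙 (d a ≟ˣ d c) * differing a) + sum (λ c → differ a c * agreeing a)
        ≡⟨ ∑-distrib-+ (λ c → 𝟙 (d a ≟ˣ d c) * differing a) _ ⟨
      sum (λ c → 𝟙 (d a ≟ˣ d c) * differing a + differ a c * agreeing a)
        ≤⟨ sum-mono-≤ bound ⟩
      pairs ∎
      where
      open ≤-Reasoning
      bound : ∀ c → 𝟙 (d a ≟ˣ d c) * differing a + differ a c * agreeing a ≤ differing c
      bound c with d a ≟ˣ d c
      ... | yes a≡c = ≤-trans (≤-reflexive (trans (+-identityʳ _) (+-identityʳ _)))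
        (sum-mono-≤ λ b → 𝟙-mono (¬? (d a ≟ˣ d b)) (¬? (d c ≟ˣ d b)) (λ a≢b c≡b → a≢b (trans a≡c c≡b)))
      ... | no a≢c = ≤-trans (≤-reflexive (+-identityʳ _))
        (sum-mono-≤ λ b → 𝟙-mono (d a ≟ˣ d b) (¬? (d c ≟ˣ d b)) (λ a≡b c≡b → a≢c (trans a≡b (sym c≡b))))

    pairs-≥-min : ∀ k → (∀ a → k ≤ differing a) → n * k ≤ pairs
    pairs-≥-min k h = ≤-trans (≤-reflexive (sym (∑-const n k))) (sum-mono-≤ h)

    0<differing : ∀ {a b} → d a ≢ d b → 1 ≤ differing a
    0<differing {a} {b} a≢b = begin
      1                                       ≡⟨ sum-δ b 1 ⟨
      sum (λ c → 𝟙 (b Fin.≟ c) * 1)           ≤⟨ sum-mono-≤ bound ⟩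
      differing a                             ∎
      where
      open ≤-Reasoning
      bound : ∀ c → 𝟙 (b Fin.≟ c) * 1 ≤ differ a c
      bound c with b Fin.≟ c
      ... | yes refl = ≤-reflexive (sym (𝟙-yes (¬? (d a ≟ˣ d b)) a≢b))
      ... | no _     = z≤n

    almost-constant : ∀ {a} → differing a ≤ 1 → ∃ λ u → ∀ b → b ≢ u → d b ≡ d a
    almost-constant {a} le with any? (λ b → ¬? (d a ≟ˣ d b))
    -- Without any exception the choice of `u` is immaterial; `a` serves as default.
    ... | no none = a , λ b _ → sym (decidable-stable (d a ≟ˣ d b) (λ ne → none (b , ne)))
    ... | yes (u , a≢u) = u , λ b b≢u → sym (decidable-stable (d a ≟ˣ d b) λ a≢b → <⇒≱ (s≤s le)
        (subst (_≤ differing a) (cong₂ _+_ (𝟙-yes (¬? (d a ≟ˣ d b)) a≢b) (𝟙-yes (¬? (d a ≟ˣ d u)) a≢u))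
          (two≤sum (differ a) b≢u)))

-- Numerical inequalities.

module Inequalities where

  open import Data.Nat
  open import Data.Nat.Properties
  open import Data.Nat.Tactic.RingSolver using (solve-∀)
  open import Relation.Binary.PropositionalEquality
  open import Relation.Nullary

  -- Since `(s - 1) * (r - 1)` is nonnegative, `s * r` is at least `s + r - 1`, which is `n`.
  product-≥ : ∀ s r {n} → 1 ≤ s → 1 ≤ r → s + r ≡ suc n → n + n ≤ s * r + r * s
  product-≥ (suc s) (suc r) {n} _ _ e = begin
    n + n                                    ≡⟨ cong₂ _+_ n≡ n≡ ⟩
    s + suc r + (s + suc r)                  ≤⟨ m≤m+n _ (s * r + s * r) ⟩
    s + suc r + (s + suc r) + (s * r + s * r) ≡⟨ expand s r ⟩
    suc s * suc r + suc r * suc s            ∎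
    where
    open ≤-Reasoning
    n≡ : n ≡ s + suc r
    n≡ = sym (suc-injective e)
    expand : ∀ s r → s + suc r + (s + suc r) + (s * r + s * r) ≡ suc s * suc r + suc r * suc s
    expand = solve-∀

  <-halve : ∀ {a b} → 2 * a < 2 * b → a < b
  <-halve {a} {b} = *-cancelˡ-< 2 a b

  -- In use `K` is `k !`, so that `suc k * K` is `suc k !`; `p` counts ordered pairs of columns and
  -- `c` is the size of the support. The factor 2 in `K * p ≤ 2 * c` is the loss from swapping two
  -- positions.
  strict-from-pairs : ∀ k K {p c} → 1 ≤ K → 4 * suc k < p → K * p ≤ 2 * c → 2 * (suc k * K) < c
  strict-from-pairs k K {p} {c} 1≤K lt le = <-halve (begin-strict
    2 * (2 * (suc k * K)) ≡⟨ rearrange k K ⟩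
    K * (4 * suc k)       <⟨ *-monoʳ-< K {{>-nonZero 1≤K}} lt ⟩
    K * p                 ≤⟨ le ⟩
    2 * c                 ∎)
    where
    open ≤-Reasoning
    rearrange : ∀ k K → 2 * (2 * (suc k * K)) ≡ K * (4 * suc k)
    rearrange = solve-∀

  -- The paper's hypothesis n ≥ 8 enters here: with n = 2 + k it says k ≥ 6, and the inequality fails at k = 5.
  strict-from-union : ∀ l K {p c₀ z x y c} → let k = 6 + l in 1 ≤ K →
    K * (k * 2 + 2 * k) ≤ p → K * (suc k + suc k) ≤ c₀ →
    (2 + k) * x ≤ x + (x + c₀ * 2) → (2 + k) * y ≤ y + (y + c₀ * 2) →
    c₀ ≤ z + (x + y) → p + z ≤ 2 * c → 2 * (suc k * K) < c
  strict-from-union l K {p} {c₀} {z} {x} {y} {c} 1≤K hp hc hx hy hz h = <-halve (begin-strict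
    2 * (2 * (suc k * K))         ≡⟨ rearrange l K ⟩
    K * (k * 2 + 2 * k) + 4 * K   <⟨ +-mono-≤-< hp (≰⇒> z≰) ⟩
    p + z                         ≤⟨ h ⟩
    2 * c                         ∎)
    where
    open ≤-Reasoning
    k = 6 + l
    rearrange : ∀ l K → 2 * (2 * ((7 + l) * K)) ≡ K * ((6 + l) * 2 + 2 * (6 + l)) + 4 * K
    rearrange = solve-∀
    cancel : ∀ x → (2 + k) * x ≤ x + (x + c₀ * 2) → k * x ≤ c₀ * 2
    cancel x hx = +-cancelˡ-≤ x _ _ (+-cancelˡ-≤ x _ _ hx)
    -- After multiplication by `k` the terms `x` and `y` cost at most `2 * c₀` each, which leaves
    -- `k - 4 = 2 + l` copies of `c₀`.
    step : (2 + l) * c₀ ≤ k * z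
    step = +-cancelʳ-≤ (c₀ * 2 + c₀ * 2) _ _ (begin
      (2 + l) * c₀ + (c₀ * 2 + c₀ * 2) ≡⟨ collect l c₀ ⟩
      k * c₀                           ≤⟨ *-monoʳ-≤ k hz ⟩
      k * (z + (x + y))                ≡⟨ distribute k z x y ⟩
      k * z + (k * x + k * y)          ≤⟨ +-monoʳ-≤ (k * z) (+-mono-≤ (cancel x hx) (cancel y hy)) ⟩
      k * z + (c₀ * 2 + c₀ * 2)        ∎)
      where
      collect : ∀ l c → (2 + l) * c + (c * 2 + c * 2) ≡ (6 + l) * c
      collect = solve-∀
      distribute : ∀ k z x y → k * (z + (x + y)) ≡ k * z + (k * x + k * y)
      distribute = solve-∀
    -- Otherwise `(2 + l) * 2 * (7 + l) ≤ 4 * (6 + l)`, which at `l = 0` reads `28 ≤ 24`.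
    z≰ : ¬ z ≤ 4 * K
    z≰ z≤ = <⇒≱ (*-monoˡ-< K {{>-nonZero 1≤K}} (24+4l<)) (begin
      (28 + (18 * l + 2 * (l * l))) * K     ≡⟨ expand l K ⟩
      (2 + l) * (K * (suc k + suc k))       ≤⟨ *-monoʳ-≤ (2 + l) hc ⟩
      (2 + l) * c₀                          ≤⟨ step ⟩
      k * z                                 ≤⟨ *-monoʳ-≤ k z≤ ⟩
      k * (4 * K)                           ≡⟨ expand′ l K ⟩
      (24 + 4 * l) * K                      ∎)
      where
      expand : ∀ l K → (28 + (18 * l + 2 * (l * l))) * K ≡ (2 + l) * (K * ((7 + l) + (7 + l)))
      expand = solve-∀
      expand′ : ∀ l K → (6 + l) * (4 * K) ≡ (24 + 4 * l) * K
      expand′ = solve-∀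
      24+4l< : 24 + 4 * l < 28 + (18 * l + 2 * (l * l))
      24+4l< = +-mono-<-≤ (m≤m+n 25 3) (≤-trans (*-monoˡ-≤ l (m≤m+n 4 14)) (m≤m+n (18 * l) _))

  -- The case of three exceptional columns and `5 + l` others, out of `n = 8 + l`.
  4·7+<6·5+ : ∀ l → 4 * (7 + l) < (5 + l) * 3 + 3 * (5 + l)
  4·7+<6·5+ l = subst₂ _<_ (left l) (right l) (+-mono-<-≤ (m≤m+n 29 1) (*-monoˡ-≤ l (m≤m+n 4 2)))
    where
    left : ∀ l → 28 + 4 * l ≡ 4 * (7 + l)
    left = solve-∀
    right : ∀ l → 30 + 6 * l ≡ (5 + l) * 3 + 3 * (5 + l)
    right = solve-∀

  -- The case where each of the `8 + l` columns differs from at least four others.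
  4·7+<8+·4 : ∀ l → 4 * (7 + l) < (8 + l) * 4
  4·7+<8+·4 l = subst (4 * (7 + l) <_) (*-comm 4 (8 + l)) (*-monoʳ-< 4 (n<1+n (7 + l)))

  -- Here every counted permutation lies in the support itself, so the bound on `p` carries no
  -- factor 2 and two exceptional columns suffice.
  strict-from-cover : ∀ l K {p c} → 1 ≤ K → (6 + l) * 2 + 2 * (6 + l) ≤ p → K * p ≤ c → 2 * ((7 + l) * K) < c
  strict-from-cover l K {p} {c} 1≤K hp h = begin-strict
    2 * ((7 + l) * K)              ≡⟨ rearrange l K ⟩
    K * (14 + 2 * l)               <⟨ *-monoʳ-< K {{>-nonZero 1≤K}} (+-mono-<-≤ (m≤m+n 15 9) (*-monoˡ-≤ l (m≤m+n 2 2))) ⟩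
    K * (24 + 4 * l)               ≡⟨ cong (K *_) (expand l) ⟩
    K * ((6 + l) * 2 + 2 * (6 + l)) ≤⟨ *-monoʳ-≤ K hp ⟩
    K * p                          ≤⟨ h ⟩
    c                              ∎
    where
    open ≤-Reasoning
    rearrange : ∀ l K → 2 * ((7 + l) * K) ≡ K * (14 + 2 * l)
    rearrange = solve-∀
    expand : ∀ l → 24 + 4 * l ≡ (6 + l) * 2 + 2 * (6 + l)
    expand = solve-∀

module Eigenfunctions (R : RealField) where

  open Counting
  open Inequalities
  open import Algebra.Bundles using (CommutativeRing)
  import Algebra.Properties.Semiring.Sum
  import Algebra.Solver.Ring
  open import Algebra.Solver.Ring.AlmostCommutativeRing using (fromCommutativeRing; _-Raw-AlmostCommutative⟶_)
  open import Data.Fin as Fin using (Fin; zero; suc; punchIn)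
  open import Data.Fin.Permutation using (_≈_; _⟨$⟩ʳ_; _⟨$⟩ˡ_; _∘ₚ_; transpose; lift₀; remove; flip; inverseˡ; inverseʳ; lift₀-remove; lift₀-cong)
  import Data.Fin.Permutation as Perm
  import Data.Fin.Permutation.Components as PC
  open import Data.Fin.Permutation.Transposition.List using (TranspositionList; eval; decompose; eval-decompose)
  open import Data.Fin.Properties using (any?; all?; ¬∀⟶∃¬; punchInᵢ≢i; suc-injective)
  open import Data.Integer as ℤ using (ℤ; -[1+_]; _⊖_)
  import Data.Integer.Properties as ℤ
  open import Data.List using ([]; _∷_; take)
  import Data.List.Extrema
  import Data.List.Properties as List
  import Data.List.Relation.Unary.All as All
  import Data.List.Relation.Unary.All.Properties as All
  import Data.List.Relation.Unary.AllPairs.Properties as AllPairs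
  import Data.Maybe as Maybe
  open import Data.Nat as ℕ using (ℕ; zero; suc; _!; z≤n)
  import Data.Nat.Properties as ℕ
  open import Data.Product using (∃; _×_; _,_; proj₁; proj₂)
  open import Data.Sum using (_⊎_; inj₁; inj₂)
  open import Function using (_∘_; Equivalence; _⇔_; mk⇔)
  open import Relation.Binary using (TotalOrder; IsTotalOrder)
  open import Relation.Binary.PropositionalEquality
  open import Relation.Nullary
  open import Relation.Nullary.Decidable using (dec⇒maybe; decidable-stable; _×-dec_)
  open import Relation.Unary using (Decidable)

  open RealField R

  -- Integers inside the reals, and the ring solver.

  ℝ-ring : CommutativeRing _ _
  ℝ-ring = record { isCommutativeRing = isCommutativeRing }

  open CommutativeRing ℝ-ring using (_-_; +-identityˡ; +-identityʳ; +-assoc; +-comm; *-identityˡ; *-identityʳ; *-assoc; *-comm; distribʳ; -‿inverseʳ; zeroˡ; zeroʳ; semiring; ring)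
  open import Algebra.Properties.Ring ring using (-‿distribˡ-*; -‿distribʳ-*; -‿involutive; -‿+-comm; -0#≈0#)
  open Algebra.Properties.Semiring.Sum semiring using (sum; sum-cong-≗; ∑-distrib-+; ∑-comm; sum-permute; *-distribˡ-sum; sum-remove)
  module ∑ = Algebra.Properties.Semiring.Sum ℕ.+-*-semiring

  ⟦_⟧ : ℕ → ℝ
  ⟦_⟧ = fromℕ R

  ⟦⟧-+ : ∀ m n → ⟦ m ℕ.+ n ⟧ ≡ ⟦ m ⟧ + ⟦ n ⟧
  ⟦⟧-+ zero    n = sym (+-identityˡ _)
  ⟦⟧-+ (suc m) n = trans (cong (1r +_) (⟦⟧-+ m n)) (sym (+-assoc _ _ _))

  ⟦⟧-* : ∀ m n → ⟦ m ℕ.* n ⟧ ≡ ⟦ m ⟧ * ⟦ n ⟧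
  ⟦⟧-* zero    n = sym (zeroˡ _)
  ⟦⟧-* (suc m) n = begin
    ⟦ n ℕ.+ m ℕ.* n ⟧              ≡⟨ ⟦⟧-+ n (m ℕ.* n) ⟩
    ⟦ n ⟧ + ⟦ m ℕ.* n ⟧            ≡⟨ cong₂ _+_ (sym (*-identityˡ _)) (⟦⟧-* m n) ⟩
    1r * ⟦ n ⟧ + ⟦ m ⟧ * ⟦ n ⟧     ≡⟨ distribʳ _ _ _ ⟨
    (1r + ⟦ m ⟧) * ⟦ n ⟧           ∎
    where open ≡-Reasoning

  fromℤ : ℤ → ℝ
  fromℤ (ℤ.+ n)    = ⟦ n ⟧
  fromℤ -[1+ n ] = - ⟦ suc n ⟧

  cancel-shift : ∀ x a b → (x + a) - (x + b) ≡ a - b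
  cancel-shift x a b = begin
    (x + a) + - (x + b)      ≡⟨ cong₂ _+_ (+-comm x a) (sym (-‿+-comm x b)) ⟩
    (a + x) + (- x + - b)    ≡⟨ +-assoc a x _ ⟩
    a + (x + (- x + - b))    ≡⟨ cong (a +_) (sym (+-assoc x _ _)) ⟩
    a + (x + - x + - b)      ≡⟨ cong (λ y → a + (y + - b)) (-‿inverseʳ x) ⟩
    a + (0r + - b)           ≡⟨ cong (a +_) (+-identityˡ _) ⟩
    a - b                    ∎
    where open ≡-Reasoning

  fromℤ-⊖ : ∀ m n → fromℤ (m ⊖ n) ≡ ⟦ m ⟧ - ⟦ n ⟧
  fromℤ-⊖ m       zero    = sym (trans (cong (⟦ m ⟧ +_) -0#≈0#) (+-identityʳ _))
  fromℤ-⊖ zero    (suc n) = sym (+-identityˡ _)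
  fromℤ-⊖ (suc m) (suc n) = trans (cong fromℤ (ℤ.[1+m]⊖[1+n]≡m⊖n m n))
    (trans (fromℤ-⊖ m n) (sym (cancel-shift 1r ⟦ m ⟧ ⟦ n ⟧)))

  fromℤ-+ : ∀ i j → fromℤ (i ℤ.+ j) ≡ fromℤ i + fromℤ j
  fromℤ-+ (ℤ.+ m)    (ℤ.+ n)    = ⟦⟧-+ m n
  fromℤ-+ (ℤ.+ m)    -[1+ n ] = fromℤ-⊖ m (suc n)
  fromℤ-+ -[1+ m ] (ℤ.+ n)    = trans (fromℤ-⊖ n (suc m)) (+-comm _ _)
  fromℤ-+ -[1+ m ] -[1+ n ] = begin
    - ⟦ suc (suc (m ℕ.+ n)) ⟧     ≡⟨ cong (λ k → - ⟦ suc k ⟧) (ℕ.+-suc m n) ⟨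
    - ⟦ suc m ℕ.+ suc n ⟧         ≡⟨ cong -_ (⟦⟧-+ (suc m) (suc n)) ⟩
    - (⟦ suc m ⟧ + ⟦ suc n ⟧)     ≡⟨ -‿+-comm _ _ ⟨
    - ⟦ suc m ⟧ + - ⟦ suc n ⟧     ∎
    where open ≡-Reasoning

  fromℤ-neg : ∀ i → fromℤ (ℤ.- i) ≡ - fromℤ i
  fromℤ-neg (ℤ.+ zero)  = sym -0#≈0#
  fromℤ-neg (ℤ.+ suc n) = refl
  fromℤ-neg -[1+ n ]  = sym (-‿involutive _)

  fromℤ-*⁺ : ∀ m j → fromℤ (ℤ.+ m ℤ.* j) ≡ ⟦ m ⟧ * fromℤ j
  fromℤ-*⁺ m (ℤ.+ n) = trans (cong fromℤ (sym (ℤ.pos-* m n))) (⟦⟧-* m n)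
  fromℤ-*⁺ m -[1+ n ] = begin
    fromℤ (ℤ.+ m ℤ.* -[1+ n ])        ≡⟨ cong fromℤ (ℤ.neg-distribʳ-* (ℤ.+ m) (ℤ.+ suc n)) ⟨
    fromℤ (ℤ.- (ℤ.+ m ℤ.* ℤ.+ suc n))   ≡⟨ fromℤ-neg (ℤ.+ m ℤ.* ℤ.+ suc n) ⟩
    - fromℤ (ℤ.+ m ℤ.* ℤ.+ suc n)       ≡⟨ cong -_ (fromℤ-*⁺ m (ℤ.+ suc n)) ⟩
    - (⟦ m ⟧ * ⟦ suc n ⟧)           ≡⟨ -‿distribʳ-* _ _ ⟩
    ⟦ m ⟧ * - ⟦ suc n ⟧             ∎
    where open ≡-Reasoning
  fromℤ-* : ∀ i j → fromℤ (i ℤ.* j) ≡ fromℤ i * fromℤ j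
  fromℤ-* (ℤ.+ m)  j = fromℤ-*⁺ m j
  fromℤ-* -[1+ m ] j = begin
    fromℤ (-[1+ m ] ℤ.* j)          ≡⟨ cong fromℤ (ℤ.neg-distribˡ-* (ℤ.+ suc m) j) ⟨
    fromℤ (ℤ.- (ℤ.+ suc m ℤ.* j))     ≡⟨ fromℤ-neg (ℤ.+ suc m ℤ.* j) ⟩
    - fromℤ (ℤ.+ suc m ℤ.* j)         ≡⟨ cong -_ (fromℤ-*⁺ (suc m) j) ⟩
    - (⟦ suc m ⟧ * fromℤ j)         ≡⟨ -‿distribˡ-* _ _ ⟩
    - ⟦ suc m ⟧ * fromℤ j           ∎
    where open ≡-Reasoning

  -- Integer coefficients let the solver normalise numerals by computation; equality of reals is
  -- decidable only through an abstract field.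
  ℤ⟶ℝ : CommutativeRing.rawRing ℤ.+-*-commutativeRing -Raw-AlmostCommutative⟶ fromCommutativeRing ℝ-ring
  ℤ⟶ℝ = record
    { ⟦_⟧ = fromℤ ; +-homo = fromℤ-+ ; *-homo = fromℤ-* ; -‿homo = fromℤ-neg
    ; 0-homo = refl ; 1-homo = +-identityʳ 1r }

  module Solver = Algebra.Solver.Ring _ (fromCommutativeRing ℝ-ring) ℤ⟶ℝ
    (λ i j → Maybe.map (cong fromℤ) (dec⇒maybe (i ℤ.≟ j)))
  open Solver using (solve; _:+_; _:*_; _:-_; :-_; _:=_; con)

  -- Order, cancellation and finite sums of reals.

  open IsTotalOrder isTotalOrder using (total) renaming (refl to ≤-refl; trans to ≤-trans; antisym to ≤-antisym)

  ℝ-order : TotalOrder _ _ _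
  ℝ-order = record { isTotalOrder = isTotalOrder }

  +-mono-≤ : ∀ {w x y z} → w ≤ x → y ≤ z → w + y ≤ x + z
  +-mono-≤ {w} {x} {y} {z} w≤x y≤z = ≤-trans (+-monoˡ-≤ y w≤x)
    (subst₂ _≤_ (+-comm y x) (+-comm z x) (+-monoˡ-≤ x y≤z))

  +-cancelʳ-≤ : ∀ {x y} z → x + z ≤ y + z → x ≤ y
  +-cancelʳ-≤ {x} {y} z h = subst₂ _≤_ (undo x) (undo y) (+-monoˡ-≤ (- z) h)
    where
    undo : ∀ x → x + z + - z ≡ x
    undo x = solve 2 (λ x z → x :+ z :+ :- z := x) refl x z

  neg-nonneg : ∀ {x} → x ≤ 0r → 0r ≤ - x
  neg-nonneg {x} x≤0 = subst₂ _≤_ (-‿inverseʳ x) (+-identityˡ _) (+-monoˡ-≤ (- x) x≤0)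

  neg-nonpos : ∀ {x} → - x ≤ 0r → 0r ≤ x
  neg-nonpos {x} h = subst (0r ≤_) (-‿involutive x) (neg-nonneg h)

  0≤1 : 0r ≤ 1r
  0≤1 with total 0r 1r
  ... | inj₁ h = h
  -- If `1 ≤ 0`, then `- 1` is nonnegative, and so is its square, which is `1`.
  ... | inj₂ h = subst (0r ≤_)
    (trans (solve 1 (λ x → :- x :* :- x := x :* x) refl 1r) (*-identityˡ 1r))
    (*-nonneg (neg-nonneg h) (neg-nonneg h))

  ⟦⟧-nonneg : ∀ n → 0r ≤ ⟦ n ⟧
  ⟦⟧-nonneg zero    = ≤-refl
  ⟦⟧-nonneg (suc n) = subst (_≤ 1r + ⟦ n ⟧) (+-identityˡ 0r) (+-mono-≤ 0≤1 (⟦⟧-nonneg n))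

  -- Characteristic zero comes from the order: `1 + n = 0` would give `1 ≤ 0`.
  ⟦suc⟧≢0 : ∀ n → ¬ ⟦ suc n ⟧ ≡ 0r
  ⟦suc⟧≢0 n e = 0≢1 (≤-antisym 0≤1 (subst₂ _≤_ (+-identityʳ 1r) e (+-mono-≤ ≤-refl (⟦⟧-nonneg n))))

  *-cancel-0 : ∀ {x y} → ¬ x ≡ 0r → x * y ≡ 0r → y ≡ 0r
  *-cancel-0 {x} {y} x≢0 xy≡0 = let x⁻¹ , xx⁻¹≡1 = inverse x x≢0 in begin
    y               ≡⟨ *-identityˡ y ⟨
    1r * y          ≡⟨ cong (_* y) xx⁻¹≡1 ⟨
    x * x⁻¹ * y     ≡⟨ solve 3 (λ x z y → x :* z :* y := z :* (x :* y)) refl x x⁻¹ y ⟩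
    x⁻¹ * (x * y)   ≡⟨ cong (x⁻¹ *_) xy≡0 ⟩
    x⁻¹ * 0r        ≡⟨ solve 1 (λ z → z :* con (ℤ.+ 0) := con (ℤ.+ 0)) refl x⁻¹ ⟩
    0r              ∎
    where open ≡-Reasoning

  x-y≡0⇒x≡y : ∀ {x y} → x - y ≡ 0r → x ≡ y
  x-y≡0⇒x≡y {x} {y} e = begin
    x           ≡⟨ solve 2 (λ x y → x := x :- y :+ y) refl x y ⟩
    x - y + y   ≡⟨ cong (_+ y) e ⟩
    0r + y      ≡⟨ +-identityˡ y ⟩
    y           ∎
    where open ≡-Reasoning

  *-cancelˡ : ∀ {x y z} → ¬ x ≡ 0r → x * y ≡ x * z → y ≡ z
  *-cancelˡ {x} {y} {z} x≢0 e = x-y≡0⇒x≡y (*-cancel-0 x≢0 (begin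
    x * (y - z)     ≡⟨ solve 3 (λ x y z → x :* (y :- z) := x :* y :- x :* z) refl x y z ⟩
    x * y - x * z   ≡⟨ cong (_- x * z) e ⟩
    x * z - x * z   ≡⟨ -‿inverseʳ _ ⟩
    0r              ∎))
    where open ≡-Reasoning

  sumFin≡sum : ∀ {n} (g : Fin n → ℝ) → sumFin R g ≡ sum g
  sumFin≡sum {zero}  g = refl
  sumFin≡sum {suc n} g = cong (_ +_) (sumFin≡sum (g ∘ suc))

  sum-const : ∀ n x → sum {n} (λ _ → x) ≡ ⟦ n ⟧ * x
  sum-const zero    x = sym (zeroˡ x)
  sum-const (suc n) x = trans (cong₂ _+_ (sym (*-identityˡ x)) (sum-const n x)) (sym (distribʳ x 1r ⟦ n ⟧))

  sum-≤ : ∀ {n} (g : Fin n → ℝ) {M : ℝ} → (∀ i → g i ≤ M) → sum g ≤ ⟦ n ⟧ * M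
  sum-≤ {n} g {M} h = subst (sum g ≤_) (sum-const n M) (mono g h)
    where
    mono : ∀ {k} (g : Fin k → ℝ) → (∀ i → g i ≤ M) → sum g ≤ sum {k} (λ _ → M)
    mono {zero}  g h = ≤-refl
    mono {suc k} g h = +-mono-≤ (h zero) (mono (g ∘ suc) (h ∘ suc))

  -- The equality case used by the maximum principle. The tail is at most `n * M`, so the head
  -- cannot fall below `M`; then the tail is tight as well.
  sum-tight : ∀ {n} (g : Fin n → ℝ) {M : ℝ} → (∀ i → g i ≤ M) → sum g ≡ ⟦ n ⟧ * M → ∀ i → g i ≡ M
  sum-tight {suc n} g {M} h e = λ { zero → head≡M ; (suc i) → sum-tight (g ∘ suc) (h ∘ suc) tail≡ i }
    where
    open ≡-Reasoning
    e′ : g zero + sum (g ∘ suc) ≡ M + ⟦ n ⟧ * M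
    e′ = trans e (trans (distribʳ M 1r ⟦ n ⟧) (cong (_+ ⟦ n ⟧ * M) (*-identityˡ M)))
    head≡M : g zero ≡ M
    head≡M = ≤-antisym (h zero) (+-cancelʳ-≤ (⟦ n ⟧ * M)
      (subst (_≤ g zero + ⟦ n ⟧ * M) e′ (+-mono-≤ ≤-refl (sum-≤ (g ∘ suc) (h ∘ suc)))))
    tail≡ : sum (g ∘ suc) ≡ ⟦ n ⟧ * M
    tail≡ = begin
      sum (g ∘ suc)                         ≡⟨ solve 2 (λ x y → y := x :+ y :- x) refl (g zero) _ ⟩
      g zero + sum (g ∘ suc) - g zero       ≡⟨ cong₂ _-_ e′ head≡M ⟩
      M + ⟦ n ⟧ * M - M                     ≡⟨ solve 2 (λ x y → x :+ y :- x := y) refl M _ ⟩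
      ⟦ n ⟧ * M                             ∎

  sum-zero : ∀ {n} (g : Fin n → ℝ) → (∀ i → g i ≡ 0r) → sum g ≡ 0r
  sum-zero {n} g h = trans (sum-cong-≗ h) (trans (sum-const n 0r) (trans (*-comm _ _) (zeroˡ _)))

  sum-change-one : ∀ {n} {g h : Fin n → ℝ} (j : Fin n) → (∀ i → i ≢ j → g i ≡ h i) → sum g + h j ≡ sum h + g j
  sum-change-one {suc n} {g} {h} j e = begin
    sum g + h j                        ≡⟨ cong (_+ h j) (sum-remove g) ⟩
    g j + sum (g ∘ punchIn j) + h j    ≡⟨ cong (λ s → g j + s + h j) (sum-cong-≗ λ i → e (punchIn j i) (punchInᵢ≢i j i)) ⟩
    g j + sum (h ∘ punchIn j) + h j    ≡⟨ solve 3 (λ x s y → x :+ s :+ y := y :+ s :+ x) refl (g j) _ (h j) ⟩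
    h j + sum (h ∘ punchIn j) + g j    ≡⟨ cong (_+ g j) (sum-remove h) ⟨
    sum h + g j                        ∎
    where open ≡-Reasoning

  sum-change-two : ∀ {n} {g h : Fin n → ℝ} (v w : Fin n) → v ≢ w → (∀ i → i ≢ v → i ≢ w → g i ≡ h i) →
    sum g + h v + h w ≡ sum h + g v + g w
  sum-change-two {n} {g} {h} v w v≢w e = begin
    sum g + h v + h w          ≡⟨ cong (λ x → sum g + x + h w) (sym mid-v) ⟩
    sum g + mid v + h w        ≡⟨ cong (_+ h w) (sum-change-one v g≈mid) ⟩
    sum mid + g v + h w        ≡⟨ solve 3 (λ s x y → s :+ x :+ y := s :+ y :+ x) refl _ (g v) (h w) ⟩
    sum mid + h w + g v        ≡⟨ cong (_+ g v) (sum-change-one w mid≈h) ⟩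
    sum h + mid w + g v        ≡⟨ cong (λ x → sum h + x + g v) mid-w ⟩
    sum h + g w + g v          ≡⟨ solve 3 (λ s x y → s :+ x :+ y := s :+ y :+ x) refl _ (g w) (g v) ⟩
    sum h + g v + g w          ∎
    where
    open ≡-Reasoning
    choose : ∀ i → Dec (i ≡ v) → ℝ
    choose i (yes _) = h i
    choose i (no _)  = g i
    -- `mid` agrees with `h` at `v` and with `g` elsewhere, which splits the change into two changes
    -- at a single index.
    mid : Fin n → ℝ
    mid i = choose i (i Fin.≟ v)
    mid-v : mid v ≡ h v
    mid-v with v Fin.≟ v
    ... | yes _  = refl
    ... | no v≢v = contradiction refl v≢v
    g≈mid : ∀ i → i ≢ v → g i ≡ mid i
    g≈mid i i≢v with i Fin.≟ v
    ... | yes i≡v = contradiction i≡v i≢v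
    ... | no _    = refl
    mid-w : mid w ≡ g w
    mid-w = sym (g≈mid w (v≢w ∘ sym))
    mid≈h : ∀ i → i ≢ w → mid i ≡ h i
    mid≈h i i≢w with i Fin.≟ v
    ... | yes _  = refl
    ... | no i≢v = e i i≢v i≢w

  sum-scale : ∀ {k} x (g : Fin k → ℝ) → sum (λ i → x * g i) ≡ x * sum g
  sum-scale x g = sym (*-distribˡ-sum x g)

  sum-neg : ∀ {k} (g : Fin k → ℝ) → sum (λ i → - g i) ≡ - sum g
  sum-neg {zero}  g = solve 0 (con (ℤ.+ 0) := :- con (ℤ.+ 0)) refl
  sum-neg {suc k} g = trans (cong (- g zero +_) (sum-neg (g ∘ suc)))
    (solve 2 (λ x y → :- x :+ :- y := :- (x :+ y)) refl (g zero) (sum (g ∘ suc)))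

  sum-minus : ∀ {k} (g h : Fin k → ℝ) → sum (λ i → g i - h i) ≡ sum g - sum h
  sum-minus g h = trans (∑-distrib-+ g (λ i → - h i)) (cong (sum g +_) (sum-neg h))

  -- Stars of transpositions and the cosets they generate.

  transpose-comm : ∀ {n} (i j : Fin n) → transpose i j ≈ transpose j i
  transpose-comm i j l = by-cases (l Fin.≟ i) (l Fin.≟ j)
    where
    by-cases : Dec (l ≡ i) → Dec (l ≡ j) → PC.transpose i j l ≡ PC.transpose j i l
    by-cases (yes refl) _          = trans (transpose-fst l j) (sym (transpose-snd j l))
    by-cases (no _)     (yes refl) = trans (transpose-snd i l) (sym (transpose-fst l i))
    by-cases (no l≢i)   (no l≢j)   = trans (transpose-other l≢i l≢j) (sym (transpose-other l≢j l≢i))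

  transpose-involutive : ∀ {n} (i j l : Fin n) → PC.transpose i j (PC.transpose i j l) ≡ l
  transpose-involutive i j l = trans (cong (PC.transpose i j) (transpose-comm i j l)) (PC.transpose-inverse i j)

  transpose-same : ∀ {n} (i : Fin n) → transpose i i ≈ Perm.id
  transpose-same i l with l Fin.≟ i
  ... | yes l≡i = sym l≡i
  ... | no l≢i with l Fin.≟ i
  ...   | yes l≡i = sym l≡i
  ...   | no _    = refl

  suc≢ : ∀ {n} {i j : Fin n} → i ≢ j → Fin.suc i ≢ suc j
  suc≢ i≢j e = i≢j (suc-injective e)

  module _ {m : ℕ} (j : Fin m) where

    s : Fin m → Sym (suc m)
    s i = transpose (suc j) (suc i)

    s-conj : ∀ {a b} → b ≢ j → b ≢ a → s a ∘ₚ s b ∘ₚ s a ≈ transpose (suc a) (suc b)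
    s-conj {a} {b} b≢j b≢a l = begin
      s a ⟨$⟩ʳ (s b ⟨$⟩ʳ (s a ⟨$⟩ʳ l))                                          ≡⟨ transpose-conj (s a) (suc j) (suc b) (s a ⟨$⟩ʳ l) ⟩
      PC.transpose (s a ⟨$⟩ʳ suc j) (s a ⟨$⟩ʳ suc b) (s a ⟨$⟩ʳ (s a ⟨$⟩ʳ l))
        ≡⟨ cong₂ (λ x y → PC.transpose x y (s a ⟨$⟩ʳ (s a ⟨$⟩ʳ l))) (transpose-fst (suc j) (suc a)) (transpose-other (suc≢ b≢j) (suc≢ b≢a)) ⟩
      PC.transpose (suc a) (suc b) (s a ⟨$⟩ʳ (s a ⟨$⟩ʳ l))                      ≡⟨ cong (PC.transpose (suc a) (suc b)) (transpose-involutive (suc j) (suc a) l) ⟩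
      PC.transpose (suc a) (suc b) l                                          ∎
      where open ≡-Reasoning

    module _ {Q : Sym (suc m) → Set} (Q-resp : ∀ π σ → π ≈ σ → Q π → Q σ)
             (closed : ∀ i {ρ} → Q ρ → Q (s i ∘ₚ ρ)) where

      -- `(a b) = (j a)(j b)(j a)`, so the star centred at `j` yields every transposition of nonzero
      -- positions. The cases `b = j` and `b = a` are not covered by this conjugation.
      closed-transpose : ∀ a b {ρ} → Q ρ → Q (transpose (suc a) (suc b) ∘ₚ ρ)
      closed-transpose a b {ρ} q with b Fin.≟ j | b Fin.≟ a
      ... | yes refl | _        = Q-resp _ _ (λ l → cong (ρ ⟨$⟩ʳ_) (transpose-comm (suc b) (suc a) l)) (closed a q)
      ... | no _     | yes refl = Q-resp _ _ (λ l → cong (ρ ⟨$⟩ʳ_) (sym (transpose-same (suc b) l))) q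
      ... | no b≢j   | no b≢a   = Q-resp _ _ (λ l → cong (ρ ⟨$⟩ʳ_) (s-conj b≢j b≢a l)) (closed a (closed b (closed a q)))

      closed-lift : ∀ (ts : TranspositionList m) {ρ} → Q ρ → Q (lift₀ (eval ts) ∘ₚ ρ)
      closed-lift []             {ρ} q = Q-resp _ _ (λ l → cong (ρ ⟨$⟩ʳ_) (sym (Perm.lift₀-id l))) q
      closed-lift ((a , b) ∷ ts) {ρ} q = Q-resp _ _
        (λ l → cong (ρ ⟨$⟩ʳ_) (trans (cong (lift₀ (eval ts) ⟨$⟩ʳ_) (Perm.lift₀-transpose a b l))
                                      (Perm.lift₀-comp (transpose a b) (eval ts) l)))
        (closed-transpose a b (closed-lift ts q))

      -- `δ` sends `l` to the position where `ρ` takes the value `σ ⟨$⟩ʳ l`. It fixes `zero`, so it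
      -- is a product of transpositions of nonzero positions, and it carries `ρ` to `σ`.
      closed-coset : ∀ {ρ σ} → ρ ⟨$⟩ʳ zero ≡ σ ⟨$⟩ʳ zero → Q ρ → Q σ
      closed-coset {ρ} {σ} e q = Q-resp _ σ ≈σ (closed-lift (decompose (remove zero δ)) q)
        where
        δ : Sym (suc m)
        δ = σ ∘ₚ flip ρ
        δ-fixes-0 : δ ⟨$⟩ʳ zero ≡ zero
        δ-fixes-0 = trans (cong (ρ ⟨$⟩ˡ_) (sym e)) (inverseˡ ρ)
        ≈σ : lift₀ (eval (decompose (remove zero δ))) ∘ₚ ρ ≈ σ
        ≈σ l = trans (cong (ρ ⟨$⟩ʳ_) (trans (lift₀-cong _ _ (eval-decompose (remove zero δ)) l) (lift₀-remove δ δ-fixes-0 l)))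
                     (inverseʳ ρ)

  -- The two star operators and the maximum principle.

  maximum : ∀ {n} {h : Sym n → ℝ} → Resp h → {P : Sym n → Set} (P? : Decidable P) → (∀ π σ → π ≈ σ → P π → P σ) →
    ∃ P → ∃ λ ρ → P ρ × (∀ σ → P σ → h σ ≤ h ρ)
  maximum {h = h} h-resp {P} P? P-resp (π₀ , p₀) =
    argmax h π₀ elements , argmax-all h {P = P} p₀ elements-satisfy , λ σ p →
      let h≤ , σ≈ = All.lookupAny (f[xs]≤f[argmax] {f = h} π₀ elements) (Equivalence.to (∈-elements σ) p)
      in subst (_≤ h (argmax h π₀ elements)) (sym (h-resp σ _ σ≈)) h≤
    where
    open Data.List.Extrema ℝ-order
    open Cardinality P? P-resp

  module Star {m : ℕ} where

    t : Fin m → Sym (suc m)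
    t i = transpose zero (suc i)

    T : (Sym (suc m) → ℝ) → Sym (suc m) → ℝ
    T g π = sum (λ i → g (t i ∘ₚ π))

    Y : Fin m → (Sym (suc m) → ℝ) → Sym (suc m) → ℝ
    Y j g π = sum (λ i → g (s j i ∘ₚ π))

    T-resp : {g : Sym (suc m) → ℝ} → Resp g → Resp (T g)
    T-resp g-resp (π) (σ) e = sum-cong-≗ λ i → g-resp (t i ∘ₚ π) (t i ∘ₚ σ) (λ l → e (t i ⟨$⟩ʳ l))

    Y-resp : ∀ {j} {g : Sym (suc m) → ℝ} → Resp g → Resp (Y j g)
    Y-resp {j} g-resp (π) (σ) e = sum-cong-≗ λ i → g-resp (s j i ∘ₚ π) (s j i ∘ₚ σ) (λ l → e (s j i ⟨$⟩ʳ l))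

    -- Conjugation by `(j k)` permutes the transpositions `(0 i)` among themselves, so for each `k`
    -- the inner sum is merely reindexed.
    T-Y-comm : ∀ j {g} → Resp g → ∀ π → Y j (T g) π ≡ T (Y j g) π
    T-Y-comm j {g} g-resp π = begin
      sum (λ k → sum (λ i → g (t i ∘ₚ s j k ∘ₚ π)))      ≡⟨ sum-cong-≗ inner ⟩
      sum (λ k → sum (λ i → g (s j k ∘ₚ t i ∘ₚ π)))      ≡⟨ ∑-comm (λ k i → g (s j k ∘ₚ t i ∘ₚ π)) ⟩
      sum (λ i → sum (λ k → g (s j k ∘ₚ t i ∘ₚ π)))      ∎
      where
      open ≡-Reasoning
      inner : ∀ k → sum (λ i → g (t i ∘ₚ s j k ∘ₚ π)) ≡ sum (λ i → g (s j k ∘ₚ t i ∘ₚ π))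
      inner k = begin
        sum (λ i → g (t i ∘ₚ s j k ∘ₚ π))
          ≡⟨ sum-cong-≗ (λ i → g-resp (t i ∘ₚ s j k ∘ₚ π) (s j k ∘ₚ t (transpose j k ⟨$⟩ʳ i) ∘ₚ π) λ l → cong (π ⟨$⟩ʳ_) (trans (transpose-conj (s j k) zero (suc i) l)
               (cong (λ x → PC.transpose zero x (s j k ⟨$⟩ʳ l)) (Perm.lift₀-transpose j k (suc i))))) ⟩
        sum (λ i → g (s j k ∘ₚ t (transpose j k ⟨$⟩ʳ i) ∘ₚ π))
          ≡⟨ sum-permute (λ i → g (s j k ∘ₚ t i ∘ₚ π)) (transpose j k) ⟨
        sum (λ i → g (s j k ∘ₚ t i ∘ₚ π)) ∎

    -- (0 i)(0 j) = (0 j)(j i) for i ≠ j; the additional summands account for i = j.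
    T-swap : ∀ j {g} → Resp g → ∀ π → T (λ ρ → g (t j ∘ₚ ρ)) π + g (t j ∘ₚ π) ≡ Y j g (t j ∘ₚ π) + g π
    T-swap j {g} g-resp π = begin
      T (λ ρ → g (t j ∘ₚ ρ)) π + g (t j ∘ₚ π)                 ≡⟨ cong (T (λ ρ → g (t j ∘ₚ ρ)) π +_) (g-resp (s j j ∘ₚ t j ∘ₚ π) (t j ∘ₚ π) λ l → cong (λ x → π ⟨$⟩ʳ (t j ⟨$⟩ʳ x)) (transpose-same (suc j) l)) ⟨
      T (λ ρ → g (t j ∘ₚ ρ)) π + g (s j j ∘ₚ t j ∘ₚ π)        ≡⟨ sum-change-one j agree ⟩
      Y j g (t j ∘ₚ π) + g (t j ∘ₚ t j ∘ₚ π)                  ≡⟨ cong (Y j g (t j ∘ₚ π) +_) (g-resp (t j ∘ₚ t j ∘ₚ π) (π) λ l → cong (π ⟨$⟩ʳ_) (transpose-involutive zero (suc j) l)) ⟩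
      Y j g (t j ∘ₚ π) + g π                                  ∎
      where
      open ≡-Reasoning
      agree : ∀ i → i ≢ j → g (t j ∘ₚ t i ∘ₚ π) ≡ g (s j i ∘ₚ t j ∘ₚ π)
      agree i i≢j = g-resp (t j ∘ₚ t i ∘ₚ π) (s j i ∘ₚ t j ∘ₚ π) λ l → cong (π ⟨$⟩ʳ_) (sym (trans (transpose-conj (t j) (suc j) (suc i) l)
        (cong₂ (λ x y → PC.transpose x y (t j ⟨$⟩ʳ l)) (transpose-snd zero (suc j)) (transpose-other {i = zero} (λ ()) (suc≢ i≢j)))))

    -- At a maximum over the coset, `m` terms bounded by the maximum add up to `m` times it, so all
    -- of them are maximal. The maximisers are thus closed under the star at `j` and fill the coset.
    Y-max : ∀ j {h} → Resp h → (∀ π → Y j h π ≡ ⟦ m ⟧ * h π) → ∀ π σ → π ⟨$⟩ʳ zero ≡ σ ⟨$⟩ʳ zero → h π ≡ h σ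
    Y-max j {h} h-resp eigen π σ e = trans (max≡ {π} refl) (sym (max≡ {σ} (sym e)))
      where
      P : Sym (suc m) → Set
      P ρ = ρ ⟨$⟩ʳ zero ≡ π ⟨$⟩ʳ zero
      peak : ∃ λ ρ → P ρ × (∀ τ → P τ → h τ ≤ h ρ)
      peak = maximum h-resp (λ ρ → ρ ⟨$⟩ʳ zero Fin.≟ π ⟨$⟩ʳ zero) (λ _ _ ρ≈τ p → trans (sym (ρ≈τ zero)) p) (π , refl)
      top = proj₁ peak
      Q : Sym (suc m) → Set
      Q ρ = P ρ × h ρ ≡ h top
      closed : ∀ i {ρ} → Q ρ → Q (s j i ∘ₚ ρ)
      -- `p` serves unchanged because `s j i` fixes `zero` by computation.
      closed i {ρ} (p , hρ) = p , sum-tight (λ i → h (s j i ∘ₚ ρ)) (λ i → proj₂ (proj₂ peak) (s j i ∘ₚ ρ) p)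
        (trans (eigen ρ) (cong (⟦ m ⟧ *_) hρ)) i
      max≡ : ∀ {τ} → P τ → h τ ≡ h top
      max≡ {τ} p = proj₂ (closed-coset j {Q} (λ ρ τ ρ≈τ (p , hρ) → trans (sym (ρ≈τ zero)) p , trans (sym (h-resp ρ τ ρ≈τ)) hρ)
        closed {top} {τ} (trans (proj₁ (proj₂ peak)) (sym p)) (proj₁ (proj₂ peak) , refl))

    -- At a global maximum the `m` terms add up to at most `m` times the maximum, yet the equation
    -- asks for `m + 1` times it; so the maximum is at most zero. The same applies to `- p`.
    Y-zero : ∀ j {p} → Resp p → (∀ π → Y j p π ≡ p π + ⟦ m ⟧ * p π) → ∀ π → p π ≡ 0r
    Y-zero j {p} p-resp eigen π = ≤-antisym (nonpos p-resp eigen π) (neg-nonpos (nonpos {λ ρ → - p ρ} (λ ρ τ e → cong -_ (p-resp ρ τ e)) eigen⁻ π))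
      where
      nonpos : ∀ {p} → Resp p → (∀ π → Y j p π ≡ p π + ⟦ m ⟧ * p π) → ∀ π → p π ≤ 0r
      -- `π ≡ π` is a predicate that always holds, so this is the maximum over the whole group.
      nonpos {p} p-resp eigen π = let top , _ , top-max = maximum p-resp {λ _ → π ≡ π} (λ _ → yes refl) (λ _ _ _ _ → refl) (π , refl) in
        ≤-trans (top-max π refl) (+-cancelʳ-≤ (⟦ m ⟧ * p top)
          (subst₂ _≤_ (eigen top) (sym (+-identityˡ _)) (sum-≤ (λ i → p (s j i ∘ₚ top)) (λ i → top-max (s j i ∘ₚ top) refl))))
      eigen⁻ : ∀ π → Y j (λ ρ → - p ρ) π ≡ - p π + ⟦ m ⟧ * - p π
      eigen⁻ π = trans (sum-neg (λ i → p (s j i ∘ₚ π))) (trans (cong -_ (eigen π))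
        (solve 2 (λ x y → :- (x :+ y :* x) := :- x :+ y :* :- x) refl (p π) ⟦ m ⟧))

  -- From an eigenfunction to a matrix.

  record Matrix {m : ℕ} (f : Sym (suc m) → ℝ) : Set where
    field
      entry    : Fin (suc m) → Fin (suc m) → ℝ
      row-zero : ∀ u → entry zero u ≡ 0r
      row-sum  : ∀ v → sum (entry v) ≡ 0r
      col-sum  : ∀ u → sum (λ v → entry v u) ≡ 0r
      -- Rows are positions and columns are values. Keeping the factor `n` on the left avoids
      -- division in the entries.
      expand   : ∀ π → ⟦ suc m ⟧ * f π ≡ sum (λ v → entry v (π ⟨$⟩ʳ v))

  -- The eigenvalue `n - 2` is written as `m - 1` by a subtraction of reals, away from truncated
  -- subtraction.
  module Structure {m : ℕ} {f : Sym (suc m) → ℝ} (f-resp : Resp f)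
    (eigen : ∀ π → Star.T f π ≡ ⟦ m ⟧ * f π - f π) where

    open Star {m}

    M : ℝ
    M = ⟦ m ⟧

    t-involutive : {g : Sym (suc m) → ℝ} → Resp g → ∀ j π → g (t j ∘ₚ t j ∘ₚ π) ≡ g π
    t-involutive g-resp j π = g-resp _ π (λ l → cong (π ⟨$⟩ʳ_) (transpose-involutive zero (suc j) l))

    module _ (j : Fin m) where

      F h : Sym (suc m) → ℝ
      F π = f (t j ∘ₚ π)
      h π = T F π - (M * F π - F π)

      F-resp : Resp F
      F-resp π σ e = f-resp (t j ∘ₚ π) (t j ∘ₚ σ) (λ l → e (t j ⟨$⟩ʳ l))

      h-resp : Resp h
      h-resp π σ e = cong₂ (λ x y → x - (M * y - y)) (T-resp F-resp π σ e) (F-resp π σ e)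

      -- `T-swap` for `F` at `t j ∘ₚ π`: translating `F` by `t j` once more gives back `f`, so the
      -- term in `T` is known from the eigenvalue equation.
      Y-F : ∀ π → Y j F π ≡ M * F π - f π
      Y-F π = begin
        Y j F π                                                  ≡⟨ t-involutive (Y-resp {j} F-resp) j π ⟨
        Y j F (t j ∘ₚ π′)                                        ≡⟨ solve 2 (λ x y → x := x :+ y :- y) refl _ (F π′) ⟩
        Y j F (t j ∘ₚ π′) + F π′ - F π′                          ≡⟨ cong (_- F π′) (T-swap j F-resp π′) ⟨
        T (λ ρ → F (t j ∘ₚ ρ)) π′ + F (t j ∘ₚ π′) - F π′         ≡⟨ cong (λ x → x + F (t j ∘ₚ π′) - F π′) (sum-cong-≗ λ i → t-involutive f-resp j (t i ∘ₚ π′)) ⟩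
        T f π′ + F (t j ∘ₚ π′) - F π′                            ≡⟨ cong₂ (λ x y → x + y - F π′) (eigen π′) (t-involutive F-resp j π) ⟩
        M * F π - F π + F π - F π′                               ≡⟨ cong (λ y → M * F π - F π + F π - y) (t-involutive f-resp j π) ⟩
        M * F π - F π + F π - f π                                ≡⟨ solve 3 (λ x y z → x :- y :+ y :- z := x :- z) refl (M * F π) (F π) (f π) ⟩
        M * F π - f π                                            ∎
        where
        open ≡-Reasoning
        π′ = t j ∘ₚ π

      -- Commuting `Y j` past `T` and inserting `Y-F` gives `M * h`, up to the term
      -- `T f - (M * f - f)` coming from the `- f` in `Y-F`; that term is zero.
      Y-h : ∀ π → Y j h π ≡ M * h π
      Y-h π = begin
        Y j h π
          ≡⟨ sum-minus (λ i → T F (s j i ∘ₚ π)) (λ i → M * F (s j i ∘ₚ π) - F (s j i ∘ₚ π)) ⟩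
        Y j (T F) π - sum (λ i → M * F (s j i ∘ₚ π) - F (s j i ∘ₚ π))
          ≡⟨ cong₂ _-_ (T-Y-comm j F-resp π) (trans (sum-minus (λ i → M * F (s j i ∘ₚ π)) (λ i → F (s j i ∘ₚ π)))
               (cong (_- Y j F π) (sum-scale M (λ i → F (s j i ∘ₚ π))))) ⟩
        T (Y j F) π - (M * Y j F π - Y j F π)
          ≡⟨ cong₂ (λ x y → x - (M * y - y)) TYF (Y-F π) ⟩
        M * T F π - (M * f π - f π) - (M * (M * F π - f π) - (M * F π - f π))
          ≡⟨ solve 4 (λ M TF F f → M :* TF :- (M :* f :- f) :- (M :* (M :* F :- f) :- (M :* F :- f)) := M :* (TF :- (M :* F :- F))) refl M (T F π) (F π) (f π) ⟩
        M * h π ∎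
        where
        open ≡-Reasoning
        TYF : T (Y j F) π ≡ M * T F π - (M * f π - f π)
        TYF = begin
          T (Y j F) π                                               ≡⟨ sum-cong-≗ (λ i → Y-F (t i ∘ₚ π)) ⟩
          sum (λ i → M * F (t i ∘ₚ π) - f (t i ∘ₚ π))               ≡⟨ sum-minus (λ i → M * F (t i ∘ₚ π)) (λ i → f (t i ∘ₚ π)) ⟩
          sum (λ i → M * F (t i ∘ₚ π)) - T f π                      ≡⟨ cong₂ _-_ (sum-scale M (λ i → F (t i ∘ₚ π))) (eigen π) ⟩
          M * T F π - (M * f π - f π)                               ∎

      -- `transpose zero u` represents the coset of permutations sending `zero` to `u`.
      η : Fin (suc m) → ℝ
      η u = h (transpose zero u)

      h≡η : ∀ π → h π ≡ η (π ⟨$⟩ʳ zero)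
      h≡η π = Y-max j h-resp Y-h π (transpose zero (π ⟨$⟩ʳ zero)) (sym (transpose-fst zero (π ⟨$⟩ʳ zero)))

      -- `T-swap` for `f` at `π′` brings in `T F π′`, hence `h π′`. Since `π′` takes at `zero` the
      -- value of `π` at `suc j`, this is where `η` is read at position `suc j`.
      Y-f : ∀ π → Y j f π ≡ M * f π - F π + η (π ⟨$⟩ʳ suc j)
      Y-f π = begin
        Y j f π                                                   ≡⟨ t-involutive (Y-resp {j} f-resp) j π ⟨
        Y j f (t j ∘ₚ π′)                                         ≡⟨ solve 2 (λ x y → x := x :+ y :- y) refl _ (F π) ⟩
        Y j f (t j ∘ₚ π′) + f π′ - F π                            ≡⟨ cong (_- F π) (T-swap j f-resp π′) ⟨
        T F π′ + F π′ - F π                                       ≡⟨ cong (λ x → T F π′ + x - F π) Fπ′ ⟩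
        T F π′ + f π - F π
          ≡⟨ solve 4 (λ M x f F → x :+ f :- F := M :* f :- F :+ (x :- (M :* f :- f))) refl M (T F π′) (f π) (F π) ⟩
        M * f π - F π + (T F π′ - (M * f π - f π))                ≡⟨ cong (λ x → M * f π - F π + (T F π′ - (M * x - x))) Fπ′ ⟨
        M * f π - F π + h π′                                      ≡⟨ cong (M * f π - F π +_) (h≡η π′) ⟩
        M * f π - F π + η (π ⟨$⟩ʳ suc j)                          ∎
        where
        open ≡-Reasoning
        π′ = t j ∘ₚ π
        Fπ′ : F π′ ≡ f π
        Fπ′ = t-involutive f-resp j π

      C : ℝ
      C = sum η

      p q : Sym (suc m) → ℝ
      p π = f π - F π
      q π = (p π + M * p π) + (η (π ⟨$⟩ʳ suc j) - η (π ⟨$⟩ʳ zero) + C)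

      p-resp : Resp p
      p-resp π σ e = cong₂ _-_ (f-resp π σ e) (F-resp π σ e)

      q-resp : Resp q
      q-resp π σ e = cong₂ _+_ (cong (λ x → x + M * x) (p-resp π σ e))
        (cong₂ (λ x y → η x - η y + C) (e (suc j)) (e zero))

      -- `Y j p` equals `n * p` plus the inhomogeneous term `η (π ⟨$⟩ʳ suc j)`; the summands added
      -- to `n * p` in `q` are those that absorb it.
      Y-q : ∀ π → Y j q π ≡ q π + M * q π
      Y-q π = begin
        Y j q π
          ≡⟨ ∑-distrib-+ (λ i → p (s j i ∘ₚ π) + M * p (s j i ∘ₚ π)) _ ⟩
        sum (λ i → p (s j i ∘ₚ π) + M * p (s j i ∘ₚ π)) + sum (λ i → η (π ⟨$⟩ʳ (s j i ⟨$⟩ʳ suc j)) - η (π ⟨$⟩ʳ zero) + C)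
          ≡⟨ cong₂ _+_ (trans (∑-distrib-+ (λ i → p (s j i ∘ₚ π)) _) (cong (Y j p π +_) (sum-scale M (λ i → p (s j i ∘ₚ π))))) Y-η ⟩
        Y j p π + M * Y j p π + (C - x₀ - M * x₀ + M * C)
          ≡⟨ cong (λ y → y + M * y + (C - x₀ - M * x₀ + M * C)) Y-p ⟩
        (p π + M * p π + x) + M * (p π + M * p π + x) + (C - x₀ - M * x₀ + M * C)
          ≡⟨ solve 5 (λ M p x x₀ C → (p :+ M :* p :+ x) :+ M :* (p :+ M :* p :+ x) :+ (C :- x₀ :- M :* x₀ :+ M :* C)
               := ((p :+ M :* p) :+ (x :- x₀ :+ C)) :+ M :* ((p :+ M :* p) :+ (x :- x₀ :+ C))) refl M (p π) x x₀ C ⟩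
        q π + M * q π ∎
        where
        open ≡-Reasoning
        x  = η (π ⟨$⟩ʳ suc j)
        x₀ = η (π ⟨$⟩ʳ zero)
        Y-p : Y j p π ≡ p π + M * p π + x
        Y-p = begin
          Y j p π                                              ≡⟨ sum-minus (λ i → f (s j i ∘ₚ π)) (λ i → F (s j i ∘ₚ π)) ⟩
          Y j f π - Y j F π                                    ≡⟨ cong₂ _-_ (Y-f π) (Y-F π) ⟩
          M * f π - F π + x - (M * F π - f π)                  ≡⟨ solve 4 (λ M f F x → M :* f :- F :+ x :- (M :* F :- f) := f :- F :+ M :* (f :- F) :+ x) refl M (f π) (F π) x ⟩
          p π + M * p π + x                                    ∎
        Y-η : sum (λ i → η (π ⟨$⟩ʳ (s j i ⟨$⟩ʳ suc j)) - x₀ + C) ≡ C - x₀ - M * x₀ + M * C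
        Y-η = begin
          sum (λ i → η (π ⟨$⟩ʳ (s j i ⟨$⟩ʳ suc j)) - x₀ + C)
            -- As `i` varies, `s j i` moves `suc j` to every nonzero position once, so all values
            -- except the one at `zero` occur and the sum of `η` over them is `C - x₀`.
            ≡⟨ sum-cong-≗ (λ i → cong (λ l → η (π ⟨$⟩ʳ l) - x₀ + C) (transpose-fst (suc j) (suc i))) ⟩
          sum (λ i → η (π ⟨$⟩ʳ suc i) - x₀ + C)
            ≡⟨ trans (∑-distrib-+ (λ i → η (π ⟨$⟩ʳ suc i) - x₀) (λ _ → C)) (cong₂ _+_ (sum-minus (λ i → η (π ⟨$⟩ʳ suc i)) (λ _ → x₀)) (sum-const m C)) ⟩
          sum (λ i → η (π ⟨$⟩ʳ suc i)) - sum {m} (λ _ → x₀) + M * C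
            ≡⟨ cong₂ (λ y z → y - z + M * C) rest (sum-const m x₀) ⟩
          C - x₀ - M * x₀ + M * C ∎
          where
          rest : sum (λ i → η (π ⟨$⟩ʳ suc i)) ≡ C - x₀
          rest = trans (solve 2 (λ x y → x := y :+ x :- y) refl _ x₀) (cong (_- x₀) (sym (sum-permute η π)))

      q≡0 : ∀ π → q π ≡ 0r
      q≡0 = Y-zero j q-resp Y-q

      -- Passing from `π` to `t j ∘ₚ π` exchanges `f` with `F` and the two values of `η`. Everything
      -- antisymmetric cancels when the two vanishing values of `q` are added, leaving `C + C`.
      C≡0 : C ≡ 0r
      C≡0 = *-cancel-0 (⟦suc⟧≢0 1) (begin
        ⟦ 2 ⟧ * C              ≡⟨ solve 1 (λ C → con (ℤ.+ 2) :* C := C :+ C) refl C ⟩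
        C + C
          ≡⟨ solve 6 (λ M f F x x₀ C → C :+ C := ((f :- F :+ M :* (f :- F)) :+ (x :- x₀ :+ C)) :+ ((F :- f :+ M :* (F :- f)) :+ (x₀ :- x :+ C)))
               refl M (f π) (F π) (η (π ⟨$⟩ʳ suc j)) (η (π ⟨$⟩ʳ zero)) C ⟩
        q π + (F π - f π + M * (F π - f π) + (η (π ⟨$⟩ʳ zero) - η (π ⟨$⟩ʳ suc j) + C))
          ≡⟨ cong₂ (λ x y → q π + (F π - x + M * (F π - x) + (η (π ⟨$⟩ʳ y) - η (π ⟨$⟩ʳ suc j) + C)))
               (sym (t-involutive f-resp j π)) (sym (transpose-snd zero (suc j))) ⟩
        q π + q (t j ∘ₚ π)     ≡⟨ cong₂ _+_ (q≡0 π) (q≡0 (t j ∘ₚ π)) ⟩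
        0r + 0r                ≡⟨ +-identityˡ 0r ⟩
        0r                     ∎)
        where
        open ≡-Reasoning
        π = transpose zero (suc j)

      difference : ∀ π → p π + M * p π ≡ η (π ⟨$⟩ʳ zero) - η (π ⟨$⟩ʳ suc j)
      difference π = begin
        p π + M * p π          ≡⟨ solve 4 (λ P x x₀ C → P := (P :+ (x :- x₀ :+ C)) :- C :+ (x₀ :- x)) refl _ x x₀ C ⟩
        q π - C + (x₀ - x)     ≡⟨ cong₂ (λ y z → y - z + (x₀ - x)) (q≡0 π) C≡0 ⟩
        0r - 0r + (x₀ - x)     ≡⟨ solve 1 (λ y → con (ℤ.+ 0) :- con (ℤ.+ 0) :+ y := y) refl _ ⟩
        x₀ - x                 ∎
        where
        open ≡-Reasoning
        x  = η (π ⟨$⟩ʳ suc j)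
        x₀ = η (π ⟨$⟩ʳ zero)

    -- The translates `F j` add up to `T f`, so the sum is `T (T f) - (M * T f - T f)` at `τ`, which
    -- vanishes because `T f` satisfies the same eigenvalue equation.
    η-sum : ∀ u → sum (λ j → η j u) ≡ 0r
    η-sum u = begin
      sum (λ j → T (F j) τ - (M * F j τ - F j τ))
        ≡⟨ sum-minus (λ j → T (F j) τ) (λ j → M * F j τ - F j τ) ⟩
      sum (λ j → T (F j) τ) - sum (λ j → M * F j τ - F j τ)
        ≡⟨ cong₂ _-_ (∑-comm (λ j i → f (t j ∘ₚ t i ∘ₚ τ))) (trans (sum-minus (λ j → M * F j τ) (λ j → F j τ)) (cong (_- T f τ) (sum-scale M (λ j → F j τ)))) ⟩
      T (T f) τ - (M * T f τ - T f τ)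
        ≡⟨ cong (_- (M * T f τ - T f τ)) TT ⟩
      M * T f τ - T f τ - (M * T f τ - T f τ)
        ≡⟨ -‿inverseʳ _ ⟩
      0r ∎
      where
      open ≡-Reasoning
      τ = transpose zero u
      TT : T (T f) τ ≡ M * T f τ - T f τ
      TT = trans (sum-cong-≗ λ i → eigen (t i ∘ₚ τ)) (trans (sum-minus (λ i → M * f (t i ∘ₚ τ)) (λ i → f (t i ∘ₚ τ)))
        (cong (_- T f τ) (sum-scale M (λ i → f (t i ∘ₚ τ)))))

    matrix : Matrix f
    matrix = record
      { entry    = entry
      ; row-zero = λ _ → refl
      ; row-sum  = row-sum
      ; col-sum  = λ u → trans (+-identityˡ _) (trans (sum-neg (λ j → η j u)) (trans (cong -_ (η-sum u)) neg0))
      ; expand   = expand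
      }
      where
      open ≡-Reasoning
      neg0 : - 0r ≡ 0r
      neg0 = solve 0 (:- con (ℤ.+ 0) := con (ℤ.+ 0)) refl
      entry : Fin (suc m) → Fin (suc m) → ℝ
      entry zero    u = 0r
      entry (suc j) u = - η j u
      row-sum : ∀ v → sum (entry v) ≡ 0r
      row-sum zero    = sum-zero {suc m} (λ _ → 0r) (λ _ → refl)
      row-sum (suc j) = trans (sum-neg (η j)) (trans (cong -_ (C≡0 j)) neg0)
      expand : ∀ π → ⟦ suc m ⟧ * f π ≡ sum (λ v → entry v (π ⟨$⟩ʳ v))
      expand π = begin
        (1r + M) * f π
          ≡⟨ trans (distribʳ (f π) 1r M) (cong (_+ M * f π) (*-identityˡ (f π))) ⟩
        f π + M * f π
          -- `f` is rewritten as `M * f - T f`, the sum of all `p j`, so that `difference` applies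
          -- summand by summand.
          ≡⟨ solve 2 (λ M f → f :+ M :* f := (M :* f :- (M :* f :- f)) :+ M :* (M :* f :- (M :* f :- f))) refl M (f π) ⟩
        (M * f π - (M * f π - f π)) + M * (M * f π - (M * f π - f π))
          ≡⟨ cong₂ (λ x y → (x - y) + M * (x - y)) (sum-const m (f π)) (eigen π) ⟨
        (sum {m} (λ _ → f π) - T f π) + M * (sum {m} (λ _ → f π) - T f π)
          ≡⟨ cong (λ x → x + M * x) (sum-minus (λ _ → f π) (λ j → F j π)) ⟨
        sum (λ j → p j π) + M * sum (λ j → p j π)
          ≡⟨ cong (sum (λ j → p j π) +_) (sum-scale M (λ j → p j π)) ⟨
        sum (λ j → p j π) + sum (λ j → M * p j π)
          ≡⟨ ∑-distrib-+ (λ j → p j π) (λ j → M * p j π) ⟨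
        sum (λ j → p j π + M * p j π)
          ≡⟨ sum-cong-≗ (λ j → difference j π) ⟩
        sum (λ j → η j (π ⟨$⟩ʳ zero) - η j (π ⟨$⟩ʳ suc j))
          ≡⟨ sum-minus (λ j → η j (π ⟨$⟩ʳ zero)) (λ j → η j (π ⟨$⟩ʳ suc j)) ⟩
        sum (λ j → η j (π ⟨$⟩ʳ zero)) - sum (λ j → η j (π ⟨$⟩ʳ suc j))
          -- The first sum vanishes, and the `0r` left in its place is the entry of row `zero`.
          ≡⟨ cong₂ _+_ (η-sum (π ⟨$⟩ʳ zero)) (sym (sum-neg (λ j → η j (π ⟨$⟩ʳ suc j)))) ⟩
        sum (λ v → entry v (π ⟨$⟩ʳ v)) ∎

  -- The transposition maps the permutations counted by c outside S injectively into S.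
  ∑ₚ-halve : ∀ {n} {S : Sym n → Set} (S? : ∀ π → Dec (S π)) → (∀ π σ → π ≈ σ → S π → S σ) → ∀ x y (c : Sym n → ℕ) → Resp c →
    (∀ π → c (transpose x y ∘ₚ π) ≡ c π) → (∀ π → ¬ c π ≡ 0 → ¬ S π → S (transpose x y ∘ₚ π)) →
    ∑ₚ c ℕ.≤ 2 ℕ.* ∑ₚ (λ π → c π ℕ.* 𝟙 (S? π))
  ∑ₚ-halve {n} {S} S? S-resp x y c c-resp c-inv sep = begin
    ∑ₚ c                                        ≤⟨ ∑ₚ-mono bound ⟩
    ∑ₚ (λ π → cS π ℕ.+ cS (τ ∘ₚ π))             ≡⟨ ∑ₚ-+ cS (λ π → cS (τ ∘ₚ π)) ⟩
    ∑ₚ cS ℕ.+ ∑ₚ (λ π → cS (τ ∘ₚ π))            ≡⟨ cong (∑ₚ cS ℕ.+_) (∑ₚ-translate τ cS-resp) ⟩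
    ∑ₚ cS ℕ.+ ∑ₚ cS                             ≡⟨ cong (∑ₚ cS ℕ.+_) (ℕ.+-identityʳ _) ⟨
    2 ℕ.* ∑ₚ cS                                 ∎
    where
    open ℕ.≤-Reasoning
    τ = transpose x y
    cS : Sym n → ℕ
    cS π = c π ℕ.* 𝟙 (S? π)
    cS-resp : Resp cS
    cS-resp π σ e = cong₂ ℕ._*_ (c-resp π σ e) (𝟙-cong (S? π) (S? σ) (S-resp π σ e) (S-resp σ π (sym ∘ e)))
    bound : ∀ π → c π ℕ.≤ cS π ℕ.+ cS (τ ∘ₚ π)
    bound π with c π ℕ.≟ 0
    ... | yes c≡0 = ℕ.≤-trans (ℕ.≤-reflexive c≡0) z≤n
    ... | no c≢0 with S? π
    ...   | yes _ = ℕ.≤-trans (ℕ.≤-reflexive (sym (ℕ.*-identityʳ (c π)))) (ℕ.m≤m+n (c π ℕ.* 1) _)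
    ...   | no ¬s = ℕ.≤-trans (ℕ.≤-reflexive (sym (trans (cong₂ ℕ._*_ (c-inv π) (𝟙-yes (S? (τ ∘ₚ π)) (sep π c≢0 ¬s))) (ℕ.*-identityʳ (c π)))))
                      (ℕ.m≤n+m (cS (τ ∘ₚ π)) _)

  -- If every value equalled `g b`, the sum would be a nonzero multiple of `g b`.
  nonconstant : ∀ {n} (g : Fin n → ℝ) → sum g ≡ 0r → ∀ {b} → ¬ g b ≡ 0r → ∃ λ b′ → ¬ g b ≡ g b′
  nonconstant {suc n} g Σ≡0 {b} gb≢0 with any? (λ b′ → ¬? (g b ≟ g b′))
  ... | yes r = r
  ... | no ¬r = contradiction (*-cancel-0 (⟦suc⟧≢0 n) (begin
    ⟦ suc n ⟧ * g b              ≡⟨ sum-const (suc n) (g b) ⟨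
    sum {suc n} (λ _ → g b)      ≡⟨ sum-cong-≗ (λ b′ → decidable-stable (g b ≟ g b′) (λ ne → ¬r (b′ , ne))) ⟩
    sum g                        ≡⟨ Σ≡0 ⟩
    0r                           ∎)) gb≢0
    where open ≡-Reasoning

  -- Lower bounds for the support from pairs of rows.

  module Support {m : ℕ} {f : Sym (suc m) → ℝ} (f-resp : Resp f) where

    S? : ∀ π → Dec (InSupp R f π)
    S? π = ¬? (f π ≟ 0r)

    S-resp : ∀ π σ → π ≈ σ → InSupp R f π → InSupp R f σ
    S-resp π σ e s fσ≡0 = s (trans (f-resp π σ e) fσ≡0)

    open Cardinality S? S-resp public

  module Cases {k : ℕ} {f : Sym (2 ℕ.+ k) → ℝ} (f-resp : Resp f) (A : Matrix f) where

    n = 2 ℕ.+ k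

    open Matrix A
    open Support f-resp

    diff : Fin n → Fin n → Fin n → ℝ
    diff v w u = entry v u - entry w u

    module U v w = Unequal _≟_ (diff v w)

    expand≡0 : ∀ {π} → f π ≡ 0r → sum (λ v → entry v (π ⟨$⟩ʳ v)) ≡ 0r
    expand≡0 {π} e = trans (sym (expand π)) (trans (cong (⟦ n ⟧ *_) e) (zeroʳ _))

    ≡0-expand : ∀ {π} → sum (λ v → entry v (π ⟨$⟩ʳ v)) ≡ 0r → f π ≡ 0r
    ≡0-expand {π} e = *-cancel-0 (⟦suc⟧≢0 (suc k)) (trans (expand π) e)

    -- The expansions at `π` and at its swap differ only in rows `v` and `w`. If both vanish, they
    -- give a relation between the four entries in these rows and the columns `π ⟨$⟩ʳ v`,
    -- `π ⟨$⟩ʳ w`.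
    swap-zero : ∀ {v w} → v ≢ w → ∀ π → f π ≡ 0r → f (transpose v w ∘ₚ π) ≡ 0r →
      diff v w (π ⟨$⟩ʳ v) ≡ diff v w (π ⟨$⟩ʳ w)
    swap-zero {v} {w} v≢w π e e′ = begin
      a - c               ≡⟨ solve 4 (λ a b c d → a :- c := (con (ℤ.+ 0) :+ a :+ b) :- c :- b) refl a b c d ⟩
      0r + a + b - c - b  ≡⟨ cong (λ x → x - c - b) swapped ⟨
      0r + d + c - c - b  ≡⟨ solve 3 (λ b c d → con (ℤ.+ 0) :+ d :+ c :- c :- b := d :- b) refl b c d ⟩
      d - b               ∎
      where
      open ≡-Reasoning
      τ = transpose v w
      a = entry v (π ⟨$⟩ʳ v)
      b = entry w (π ⟨$⟩ʳ w)
      c = entry w (π ⟨$⟩ʳ v)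
      d = entry v (π ⟨$⟩ʳ w)
      swapped : 0r + d + c ≡ 0r + a + b
      swapped = begin
        0r + d + c
          ≡⟨ cong₂ (λ x y → x + entry v (π ⟨$⟩ʳ y) + c) (expand≡0 {π} e) (transpose-fst v w) ⟨
        sum (λ i → entry i (π ⟨$⟩ʳ i)) + entry v (π ⟨$⟩ʳ (τ ⟨$⟩ʳ v)) + c
          ≡⟨ cong (λ y → sum (λ i → entry i (π ⟨$⟩ʳ i)) + entry v (π ⟨$⟩ʳ (τ ⟨$⟩ʳ v)) + entry w (π ⟨$⟩ʳ y)) (transpose-snd v w) ⟨
        sum (λ i → entry i (π ⟨$⟩ʳ i)) + entry v (π ⟨$⟩ʳ (τ ⟨$⟩ʳ v)) + entry w (π ⟨$⟩ʳ (τ ⟨$⟩ʳ w))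
          ≡⟨ sum-change-two v w v≢w (λ i i≢v i≢w → cong (λ y → entry i (π ⟨$⟩ʳ y)) (sym (transpose-other i≢v i≢w))) ⟩
        sum (λ i → entry i (π ⟨$⟩ʳ (τ ⟨$⟩ʳ i))) + a + b
          ≡⟨ cong (λ x → x + a + b) (expand≡0 {τ ∘ₚ π} e′) ⟩
        0r + a + b ∎

    swap-support : ∀ {v w} → v ≢ w → ∀ π → ¬ diff v w (π ⟨$⟩ʳ v) ≡ diff v w (π ⟨$⟩ʳ w) →
      ¬ InSupp R f π → InSupp R f (transpose v w ∘ₚ π)
    swap-support v≢w π ne ¬s e′ = ne (swap-zero v≢w π (decidable-stable (f π ≟ 0r) ¬s) e′)

    ∑ₚ-differ : ∀ {v w} x y → v ≢ w → ∑ₚ (λ π → U.differ x y (π ⟨$⟩ʳ v) (π ⟨$⟩ʳ w)) ≡ k ! ℕ.* U.pairs x y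
    ∑ₚ-differ x y v≢w = two-positions v≢w (U.differ x y) (U.differ-diag x y)

    -- Among `π` and its swap, at least one lies in the support once `diff v w` separates the values
    -- at `v` and `w`; `k !` permutations belong to each ordered pair of such values.
    pairs-bound : ∀ {v w} → v ≢ w → k ! ℕ.* U.pairs v w ℕ.≤ 2 ℕ.* card
    pairs-bound {v} {w} v≢w = begin
      k ! ℕ.* U.pairs v w                                                ≡⟨ ∑ₚ-differ v w v≢w ⟨
      ∑ₚ c                                                              ≤⟨ ∑ₚ-halve S? S-resp v w c (λ π σ e → cong₂ (U.differ v w) (e v) (e w)) c-inv
                                                                            (λ π ne → swap-support v≢w π (U.differ≢0 v w ne)) ⟩
      2 ℕ.* ∑ₚ (λ π → c π ℕ.* 𝟙 (S? π))                                  ≤⟨ ℕ.*-monoʳ-≤ 2 (∑ₚ-mono λ π → ℕ.≤-trans (ℕ.*-monoˡ-≤ (𝟙 (S? π)) (U.differ≤1 v w (π ⟨$⟩ʳ v) (π ⟨$⟩ʳ w))) (ℕ.≤-reflexive (ℕ.+-identityʳ _))) ⟩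
      2 ℕ.* card                                                         ∎
      where
      open ℕ.≤-Reasoning
      c : Sym n → ℕ
      c π = U.differ v w (π ⟨$⟩ʳ v) (π ⟨$⟩ʳ w)
      c-inv : ∀ π → c (transpose v w ∘ₚ π) ≡ c π
      c-inv π = trans (cong₂ (λ x y → U.differ v w (π ⟨$⟩ʳ x) (π ⟨$⟩ʳ y)) (transpose-fst v w) (transpose-snd v w))
        (U.differ-sym v w (π ⟨$⟩ʳ w) (π ⟨$⟩ʳ v))

    Strict : Set
    Strict = 2 ℕ.* (suc k !) ℕ.< card

    differing-pairs : ∀ v w {a r s} → U.differing v w a ≡ r → s ℕ.+ r ≡ n → s ℕ.* r ℕ.+ r ℕ.* s ℕ.≤ U.pairs v w
    differing-pairs v w {a} {r} {s} refl e = subst (λ s → s ℕ.* r ℕ.+ r ℕ.* s ℕ.≤ U.pairs v w)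
      (ℕ.+-cancelʳ-≡ r (U.agreeing v w a) s (trans (U.agreeing+differing v w a) (sym e))) (U.pairs-≥ v w a)

    nonconstant-pairs : ∀ v w {a b} → ¬ diff v w a ≡ diff v w b → suc k ℕ.+ suc k ℕ.≤ U.pairs v w
    nonconstant-pairs v w {a} {b} ne = ℕ.≤-trans
      (product-≥ (U.agreeing v w a) (U.differing v w a) 1≤agreeing (U.0<differing v w ne) (U.agreeing+differing v w a))
      (U.pairs-≥ v w a)
      where
      1≤agreeing : 1 ℕ.≤ U.agreeing v w a
      1≤agreeing = ℕ.n≢0⇒n>0 λ z → ℕ.<⇒≱ (ℕ.≤-reflexive refl) (ℕ.≤-trans
        (ℕ.≤-trans (ℕ.≤-reflexive (sym (𝟙-yes (diff v w a ≟ diff v w a) refl))) (single (λ b → 𝟙 (diff v w a ≟ diff v w b)) a))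
        (ℕ.≤-reflexive z))
        where
        single : ∀ {n} (g : Fin n → ℕ) i → g i ℕ.≤ ∑.sum g
        single {suc n} g i = ℕ.≤-trans (ℕ.m≤m+n (g i) _) (ℕ.≤-reflexive (sym (∑.sum-remove {i = i} g)))

    -- `c₁` selects the permutations whose values at `v`, `w` are separated by `diff v w`. `c₂`
    -- selects those separated by `diff x y` whose values at `v`, `w` both lie in the level set of
    -- `a`, which excludes `c₁`. Disjointness of the two pairs of positions makes `c₂` invariant
    -- under swapping `x` and `y`.
    module Union {v w x y a : Fin n} (v≢w : v ≢ w) (x≢y : x ≢ y) (x≢v : x ≢ v) (x≢w : x ≢ w) (y≢v : y ≢ v) (y≢w : y ≢ w) where

      open ℕ.≤-Reasoning

      agree : Fin n → ℕ
      agree b = 𝟙 (diff v w a ≟ diff v w b)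

      c₁ c₀ c₂ : Sym n → ℕ
      c₁ π = U.differ v w (π ⟨$⟩ʳ v) (π ⟨$⟩ʳ w)
      c₀ π = U.differ x y (π ⟨$⟩ʳ x) (π ⟨$⟩ʳ y)
      c₂ π = c₀ π ℕ.* (agree (π ⟨$⟩ʳ v) ℕ.* agree (π ⟨$⟩ʳ w))

      outside : Fin n → ℕ
      outside z = ∑ₚ (λ π → c₀ π ℕ.* U.differ v w a (π ⟨$⟩ʳ z))

      outside-bound : ∀ {z} → z ≢ x → z ≢ y → n ℕ.* outside z ℕ.≤ outside z ℕ.+ (outside z ℕ.+ ∑ₚ c₀ ℕ.* U.differing v w a)
      outside-bound z≢x z≢y = third-position z≢x z≢y (U.differ x y) (U.differ v w a)

      -- A permutation counted by `c₀` but not by `c₂` takes at `v` or at `w` a value outside the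
      -- level set of `a`.
      c₀-cover : ∑ₚ c₀ ℕ.≤ ∑ₚ c₂ ℕ.+ (outside v ℕ.+ outside w)
      c₀-cover = begin
        ∑ₚ c₀                                     ≤⟨ ∑ₚ-mono cover ⟩
        ∑ₚ (λ π → c₂ π ℕ.+ (o v π ℕ.+ o w π))     ≡⟨ ∑ₚ-+ c₂ (λ π → o v π ℕ.+ o w π) ⟩
        ∑ₚ c₂ ℕ.+ ∑ₚ (λ π → o v π ℕ.+ o w π)      ≡⟨ cong (∑ₚ c₂ ℕ.+_) (∑ₚ-+ (o v) (o w)) ⟩
        ∑ₚ c₂ ℕ.+ (outside v ℕ.+ outside w)       ∎
        where
        o : Fin n → Sym n → ℕ
        o z π = c₀ π ℕ.* U.differ v w a (π ⟨$⟩ʳ z)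
        cover : ∀ π → c₀ π ℕ.≤ c₂ π ℕ.+ (o v π ℕ.+ o w π)
        cover π with diff v w a ≟ diff v w (π ⟨$⟩ʳ v) | diff v w a ≟ diff v w (π ⟨$⟩ʳ w)
        ... | yes _ | yes _ = ℕ.≤-trans (ℕ.≤-reflexive (sym (ℕ.*-identityʳ (c₀ π)))) (ℕ.m≤m+n (c₀ π ℕ.* 1) _)
        ... | no _  | _     = ℕ.≤-trans (ℕ.≤-reflexive (sym (ℕ.*-identityʳ (c₀ π))))
          (ℕ.≤-trans (ℕ.m≤m+n (c₀ π ℕ.* 1) _) (ℕ.m≤n+m _ (c₀ π ℕ.* 0)))
        ... | yes _ | no _  = ℕ.≤-trans (ℕ.≤-reflexive (sym (ℕ.*-identityʳ (c₀ π))))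
          (ℕ.≤-trans (ℕ.m≤n+m (c₀ π ℕ.* 1) (c₀ π ℕ.* 0)) (ℕ.m≤n+m _ (c₀ π ℕ.* 0)))

      c₁-inv : ∀ π → c₁ (transpose v w ∘ₚ π) ≡ c₁ π
      c₁-inv π = trans (cong₂ (λ i j → U.differ v w (π ⟨$⟩ʳ i) (π ⟨$⟩ʳ j)) (transpose-fst v w) (transpose-snd v w))
        (U.differ-sym v w (π ⟨$⟩ʳ w) (π ⟨$⟩ʳ v))

      c₂-inv : ∀ π → c₂ (transpose x y ∘ₚ π) ≡ c₂ π
      c₂-inv π = cong₂ ℕ._*_
        (trans (cong₂ (λ i j → U.differ x y (π ⟨$⟩ʳ i) (π ⟨$⟩ʳ j)) (transpose-fst x y) (transpose-snd x y))
               (U.differ-sym x y (π ⟨$⟩ʳ y) (π ⟨$⟩ʳ x)))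
        (cong₂ (λ i j → agree (π ⟨$⟩ʳ i) ℕ.* agree (π ⟨$⟩ʳ j))
          (transpose-other (x≢v ∘ sym) (y≢v ∘ sym)) (transpose-other (x≢w ∘ sym) (y≢w ∘ sym)))

      disjoint : ∀ π → c₁ π ℕ.+ c₂ π ℕ.≤ 1
      disjoint π with diff v w a ≟ diff v w (π ⟨$⟩ʳ v) | diff v w a ≟ diff v w (π ⟨$⟩ʳ w) | c₀≤1
        where
        c₀≤1 : c₀ π ℕ.≤ 1
        c₀≤1 = U.differ≤1 x y (π ⟨$⟩ʳ x) (π ⟨$⟩ʳ y)
      ... | yes e | yes e′ | le = subst (λ i → i ℕ.+ c₀ π ℕ.* 1 ℕ.≤ 1)
            (sym (𝟙-no (¬? (diff v w (π ⟨$⟩ʳ v) ≟ diff v w (π ⟨$⟩ʳ w))) (contradiction (trans (sym e) e′))))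
            (ℕ.≤-trans (ℕ.≤-reflexive (ℕ.*-identityʳ (c₀ π))) le)
      ... | no _  | _     | _ = subst (λ i → c₁ π ℕ.+ i ℕ.≤ 1) (sym (ℕ.*-zeroʳ (c₀ π))) (ℕ.≤-trans (ℕ.≤-reflexive (ℕ.+-identityʳ (c₁ π))) (U.differ≤1 v w (π ⟨$⟩ʳ v) (π ⟨$⟩ʳ w)))
      ... | yes _ | no _  | _ = subst (λ i → c₁ π ℕ.+ i ℕ.≤ 1) (sym (ℕ.*-zeroʳ (c₀ π))) (ℕ.≤-trans (ℕ.≤-reflexive (ℕ.+-identityʳ (c₁ π))) (U.differ≤1 v w (π ⟨$⟩ʳ v) (π ⟨$⟩ʳ w)))

      -- Each family is halved by its own transposition; `disjoint` prevents an element of the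
      -- support from being counted twice.
      union-bound : ∑ₚ c₁ ℕ.+ ∑ₚ c₂ ℕ.≤ 2 ℕ.* card
      union-bound = begin
        ∑ₚ c₁ ℕ.+ ∑ₚ c₂
          ≤⟨ ℕ.+-mono-≤
               (∑ₚ-halve S? S-resp v w c₁ (λ π σ e → cong₂ (U.differ v w) (e v) (e w)) c₁-inv
                 (λ π ne → swap-support v≢w π (U.differ≢0 v w ne)))
               (∑ₚ-halve S? S-resp x y c₂ (λ π σ e → cong₂ ℕ._*_ (cong₂ (U.differ x y) (e x) (e y)) (cong₂ ℕ._*_ (cong agree (e v)) (cong agree (e w)))) c₂-inv
                 (λ π ne → swap-support x≢y π (U.differ≢0 x y λ z → ne (cong (ℕ._* (agree (π ⟨$⟩ʳ v) ℕ.* agree (π ⟨$⟩ʳ w))) z)))) ⟩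
        2 ℕ.* ∑ₚ c₁S ℕ.+ 2 ℕ.* ∑ₚ c₂S             ≡⟨ ℕ.*-distribˡ-+ 2 (∑ₚ c₁S) (∑ₚ c₂S) ⟨
        2 ℕ.* (∑ₚ c₁S ℕ.+ ∑ₚ c₂S)                 ≡⟨ cong (2 ℕ.*_) (∑ₚ-+ c₁S c₂S) ⟨
        2 ℕ.* ∑ₚ (λ π → c₁S π ℕ.+ c₂S π)          ≤⟨ ℕ.*-monoʳ-≤ 2 (∑ₚ-mono λ π → begin
          c₁S π ℕ.+ c₂S π                           ≡⟨ ℕ.*-distribʳ-+ (𝟙 (S? π)) (c₁ π) (c₂ π) ⟨
          (c₁ π ℕ.+ c₂ π) ℕ.* 𝟙 (S? π)              ≤⟨ ℕ.*-monoˡ-≤ (𝟙 (S? π)) (disjoint π) ⟩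
          1 ℕ.* 𝟙 (S? π)                            ≡⟨ ℕ.*-identityˡ _ ⟩
          𝟙 (S? π)                                  ∎) ⟩
        2 ℕ.* card                                ∎
        where
        c₁S c₂S : Sym n → ℕ
        c₁S π = c₁ π ℕ.* 𝟙 (S? π)
        c₂S π = c₂ π ℕ.* 𝟙 (S? π)

  -- The functions of the family and their support.

  fF-first : ∀ {n} {u v w : Fin n} (π : Sym n) → π ⟨$⟩ʳ v ≡ u → fF R u v w π ≡ 1r
  fF-first {u = u} {v} π e with π ⟨$⟩ʳ v Fin.≟ u
  ... | yes _ = refl
  ... | no ne = contradiction e ne

  fF-second : ∀ {n} {u v w : Fin n} (π : Sym n) → ¬ π ⟨$⟩ʳ v ≡ u → π ⟨$⟩ʳ w ≡ u → fF R u v w π ≡ - 1r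
  fF-second {u = u} {v} {w} π ne e with π ⟨$⟩ʳ v Fin.≟ u
  ... | yes e′ = contradiction e′ ne
  ... | no _ with π ⟨$⟩ʳ w Fin.≟ u
  ...   | yes _ = refl
  ...   | no ne′ = contradiction e ne′

  fF-neither : ∀ {n} {u v w : Fin n} (π : Sym n) → ¬ π ⟨$⟩ʳ v ≡ u → ¬ π ⟨$⟩ʳ w ≡ u → fF R u v w π ≡ 0r
  fF-neither {u = u} {v} {w} π ne ne′ with π ⟨$⟩ʳ v Fin.≟ u
  ... | yes e = contradiction e ne
  ... | no _ with π ⟨$⟩ʳ w Fin.≟ u
  ...   | yes e = contradiction e ne′
  ...   | no _ = refl

  ∑ₚ-maps-to : ∀ {m} (v u : Fin (suc m)) → ∑ₚ (λ π → 𝟙 (u Fin.≟ π ⟨$⟩ʳ v)) ≡ m !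
  ∑ₚ-maps-to {m} v u = trans (one-position v (λ j → 𝟙 (u Fin.≟ j)))
    (trans (cong (m ! ℕ.*_) (sum-𝟙≟ u)) (ℕ.*-identityʳ (m !)))

  neg-nonzero : ∀ {x} → ¬ x ≡ 0r → ¬ x * - 1r ≡ 0r
  neg-nonzero {x} x≢0 e = x≢0 (begin
    x                    ≡⟨ *-identityʳ x ⟨
    x * 1r               ≡⟨ solve 2 (λ x y → x :* y := :- (x :* :- y)) refl x 1r ⟩
    - (x * - 1r)         ≡⟨ cong -_ e ⟩
    - 0r                 ≡⟨ solve 0 (:- con (ℤ.+ 0) := con (ℤ.+ 0)) refl ⟩
    0r                   ∎)
    where open ≡-Reasoning

  module Multiple {m : ℕ} {f : Sym (suc m) → ℝ} (f-resp : Resp f) where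

    open Support f-resp

    -- The support consists of the permutations taking the value `u` at `v` or at `w`. These exclude
    -- each other by injectivity, and each accounts for `m !` permutations.
    card-multiple : IsMultipleOfF R m f → card ≡ 2 ℕ.* m !
    card-multiple (c , c≢0 , u , v , w , _ , _ , v≢w , f≡) = begin
      card                                                               ≡⟨ ∑ₚ-cong pointwise ⟩
      ∑ₚ (λ π → 𝟙 (u Fin.≟ π ⟨$⟩ʳ v) ℕ.+ 𝟙 (u Fin.≟ π ⟨$⟩ʳ w))           ≡⟨ ∑ₚ-+ (λ π → 𝟙 (u Fin.≟ π ⟨$⟩ʳ v)) (λ π → 𝟙 (u Fin.≟ π ⟨$⟩ʳ w)) ⟩
      ∑ₚ (λ π → 𝟙 (u Fin.≟ π ⟨$⟩ʳ v)) ℕ.+ ∑ₚ (λ π → 𝟙 (u Fin.≟ π ⟨$⟩ʳ w)) ≡⟨ cong₂ ℕ._+_ (∑ₚ-maps-to v u) (∑ₚ-maps-to w u) ⟩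
      m ! ℕ.+ m !                                                        ≡⟨ cong (m ! ℕ.+_) (ℕ.+-identityʳ (m !)) ⟨
      2 ℕ.* m !                                                          ∎
      where
      open ≡-Reasoning
      pointwise : ∀ π → 𝟙 (S? π) ≡ 𝟙 (u Fin.≟ π ⟨$⟩ʳ v) ℕ.+ 𝟙 (u Fin.≟ π ⟨$⟩ʳ w)
      pointwise π with u Fin.≟ π ⟨$⟩ʳ v | u Fin.≟ π ⟨$⟩ʳ w
      ... | yes e | yes e′ = contradiction (perm-injective π (trans (sym e) e′)) v≢w
      ... | yes e | no _   = 𝟙-yes (S? π) λ fπ≡0 → c≢0 (trans (sym (*-identityʳ c))
            (trans (cong (c *_) (sym (fF-first π (sym e)))) (trans (sym (f≡ π)) fπ≡0)))
      ... | no ne | yes e  = 𝟙-yes (S? π) λ fπ≡0 → neg-nonzero c≢0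
            (trans (cong (c *_) (sym (fF-second π (ne ∘ sym) (sym e)))) (trans (sym (f≡ π)) fπ≡0))
      ... | no ne | no ne′ = 𝟙-no (S? π) λ fπ≢0 → fπ≢0
            (trans (f≡ π) (trans (cong (c *_) (fF-neither π (ne ∘ sym) (ne′ ∘ sym))) (zeroʳ c)))

  -- Matrices whose rows are constant away from one column.

  module SingleColumn {k : ℕ} {f : Sym (2 ℕ.+ k) → ℝ} (f-resp : Resp f) (A : Matrix f) (f-nonzero : ∃ λ π → ¬ f π ≡ 0r) (u : Fin (2 ℕ.+ k))
    (off-column : ∀ v {b b′} → b ≢ u → b′ ≢ u → Matrix.entry A v b ≡ Matrix.entry A v b′) where

    open Matrix A
    open Support f-resp
    open Cases f-resp A using (n; Strict; ≡0-expand)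

    b : Fin n
    b = punchIn u zero

    b≢u : b ≢ u
    b≢u = punchInᵢ≢i u zero

    -- The jump of row `v` at column `u` over its constant value elsewhere.
    γ : Fin n → ℝ
    γ v = entry v u - entry v b

    -- Every row other than `v` meets `π` off column `u`, so its entry may be moved to column `b`;
    -- the sum over column `b` is zero, and only row `v` needs correcting.
    value : ∀ π {v} → π ⟨$⟩ʳ v ≡ u → ⟦ n ⟧ * f π ≡ γ v
    value π {v} πv≡u = begin
      ⟦ n ⟧ * f π                                                       ≡⟨ expand π ⟩
      sum (λ i → entry i (π ⟨$⟩ʳ i))                                    ≡⟨ solve 2 (λ x y → x := x :+ y :- y) refl _ (entry v b) ⟩
      sum (λ i → entry i (π ⟨$⟩ʳ i)) + entry v b - entry v b            ≡⟨ cong (_- entry v b) (sum-change-one v others) ⟩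
      sum (λ i → entry i b) + entry v (π ⟨$⟩ʳ v) - entry v b            ≡⟨ cong₂ (λ x y → x + entry v y - entry v b) (col-sum b) πv≡u ⟩
      0r + entry v u - entry v b                                        ≡⟨ cong (_- entry v b) (+-identityˡ _) ⟩
      γ v                                                               ∎
      where
      open ≡-Reasoning
      others : ∀ i → i ≢ v → entry i (π ⟨$⟩ʳ i) ≡ entry i b
      others i i≢v = off-column i (λ e → i≢v (perm-injective π (trans e (sym πv≡u)))) b≢u

    γ-sum : sum γ ≡ 0r
    γ-sum = trans (sum-minus (λ v → entry v u) (λ v → entry v b)) (trans (cong₂ _-_ (col-sum u) (col-sum b)) (-‿inverseʳ 0r))

    γ-zero : γ zero ≡ 0r
    γ-zero = trans (cong₂ _-_ (row-zero u) (row-zero b)) (-‿inverseʳ 0r)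

    support : ∀ π {v} → π ⟨$⟩ʳ v ≡ u → ¬ γ v ≡ 0r → InSupp R f π
    support π e γ≢0 fπ≡0 = γ≢0 (trans (sym (value π e)) (trans (cong (⟦ n ⟧ *_) fπ≡0) (zeroʳ _)))

    first : ∃ λ v → ¬ γ v ≡ 0r
    first = let π , fπ≢0 = f-nonzero in π ⟨$⟩ˡ u , λ γ≡0 →
      fπ≢0 (*-cancel-0 (⟦suc⟧≢0 (suc k)) (trans (value π (inverseʳ π)) γ≡0))

    -- Since `γ` sums to zero, it cannot have exactly one nonzero value.
    rest-zero : ∀ {v} → (∀ w → w ≢ v → γ w ≡ 0r) → γ v ≡ 0r
    rest-zero {v} h = begin
      γ v                            ≡⟨ +-identityˡ (γ v) ⟨
      0r + γ v                       ≡⟨ cong (_+ γ v) (sum-zero {n} (λ _ → 0r) (λ _ → refl)) ⟨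
      sum {n} (λ _ → 0r) + γ v       ≡⟨ sum-change-one {g = γ} {λ _ → 0r} v h ⟨
      sum γ + 0r                     ≡⟨ trans (+-identityʳ _) γ-sum ⟩
      0r                             ∎
      where open ≡-Reasoning

    -- The value `u` occurs at one position only, so three nonzero values of `γ` give three disjoint
    -- families of `suc k !` permutations in the support.
    three-rows : ∀ {v w z} → v ≢ w → z ≢ v → z ≢ w → ¬ γ v ≡ 0r → ¬ γ w ≡ 0r → ¬ γ z ≡ 0r → Strict
    three-rows {v} {w} {z} v≢w z≢v z≢w γv γw γz = begin-strict
      2 ℕ.* (suc k !)                                  <⟨ ℕ.*-monoˡ-< (suc k !) {{ℕ.>-nonZero (ℕ.1≤n! (suc k))}} (ℕ.n<1+n 2) ⟩
      3 ℕ.* (suc k !)                                  ≡⟨ cong (λ x → suc k ! ℕ.+ (suc k ! ℕ.+ x)) (ℕ.+-identityʳ (suc k !)) ⟩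
      suc k ! ℕ.+ (suc k ! ℕ.+ suc k !)                ≡⟨ cong₂ ℕ._+_ (∑ₚ-maps-to v u) (cong₂ ℕ._+_ (∑ₚ-maps-to w u) (∑ₚ-maps-to z u)) ⟨
      ∑ₚ (i v) ℕ.+ (∑ₚ (i w) ℕ.+ ∑ₚ (i z))             ≡⟨ cong (∑ₚ (i v) ℕ.+_) (∑ₚ-+ (i w) (i z)) ⟨
      ∑ₚ (i v) ℕ.+ ∑ₚ (λ π → i w π ℕ.+ i z π)          ≡⟨ ∑ₚ-+ (i v) (λ π → i w π ℕ.+ i z π) ⟨
      ∑ₚ (λ π → i v π ℕ.+ (i w π ℕ.+ i z π))           ≤⟨ ∑ₚ-mono bound ⟩
      card                                             ∎
      where
      open ℕ.≤-Reasoning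
      i : Fin n → Sym n → ℕ
      i v π = 𝟙 (u Fin.≟ π ⟨$⟩ʳ v)
      apart : ∀ π {v w} → v ≢ w → u ≡ π ⟨$⟩ʳ v → ¬ u ≡ π ⟨$⟩ʳ w
      apart π v≢w e e′ = v≢w (perm-injective π (trans (sym e) e′))
      in-support : ∀ π {v} → ¬ γ v ≡ 0r → u ≡ π ⟨$⟩ʳ v → 1 ℕ.≤ 𝟙 (S? π)
      in-support π γ≢0 e = ℕ.≤-reflexive (sym (𝟙-yes (S? π) (support π (sym e) γ≢0)))
      bound : ∀ π → i v π ℕ.+ (i w π ℕ.+ i z π) ℕ.≤ 𝟙 (S? π)
      bound π with u Fin.≟ π ⟨$⟩ʳ v | u Fin.≟ π ⟨$⟩ʳ w | u Fin.≟ π ⟨$⟩ʳ z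
      ... | yes e | yes e′ | _      = contradiction e′ (apart π v≢w e)
      ... | yes e | no _   | yes e′ = contradiction e (apart π z≢v e′)
      ... | yes e | no _   | no _   = in-support π γv e
      ... | no _  | yes e  | yes e′ = contradiction e (apart π z≢w e′)
      ... | no _  | yes e  | no _   = in-support π γw e
      ... | no _  | no _   | yes e  = in-support π γz e
      ... | no _  | no _   | no _   = z≤n

    -- The zero sum forces `γ w` to be `- γ v`, so `n * f` is `γ v` times `fF R u v w`. Neither `v`
    -- nor `w` is `zero`, as `γ zero` vanishes.
    two-rows : (∃ λ N⁻¹ → ⟦ n ⟧ * N⁻¹ ≡ 1r) →
      ∀ {v w} → v ≢ w → ¬ γ v ≡ 0r → ¬ γ w ≡ 0r → (∀ z → z ≢ v → z ≢ w → γ z ≡ 0r) → IsMultipleOfF R (suc k) f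
    two-rows (N⁻¹ , NN⁻¹) {v} {w} v≢w γv γw others =
      c , c≢0 , u , v , w , (λ { refl → γv γ-zero }) , (λ { refl → γw γ-zero }) , v≢w , formula
      where
      open ≡-Reasoning
      c : ℝ
      c = N⁻¹ * γ v
      Nc : ⟦ n ⟧ * c ≡ γ v
      Nc = trans (sym (*-assoc _ _ _)) (trans (cong (_* γ v) NN⁻¹) (*-identityˡ _))
      c≢0 : ¬ c ≡ 0r
      c≢0 e = γv (trans (sym Nc) (trans (cong (⟦ n ⟧ *_) e) (zeroʳ _)))
      γw≡-γv : γ w ≡ - γ v
      γw≡-γv = begin
        γ w                                     ≡⟨ solve 2 (λ x y → y := con (ℤ.+ 0) :+ x :+ y :- x) refl (γ v) (γ w) ⟩
        0r + γ v + γ w - γ v                    ≡⟨ cong (λ s → s + γ v + γ w - γ v) (sum-zero {n} (λ _ → 0r) (λ _ → refl)) ⟨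
        sum {n} (λ _ → 0r) + γ v + γ w - γ v    ≡⟨ cong (_- γ v) (sum-change-two {g = γ} {λ _ → 0r} v w v≢w others) ⟨
        sum γ + 0r + 0r - γ v                   ≡⟨ cong (λ s → s + 0r + 0r - γ v) γ-sum ⟩
        0r + 0r + 0r - γ v                      ≡⟨ solve 1 (λ x → con (ℤ.+ 0) :+ con (ℤ.+ 0) :+ con (ℤ.+ 0) :- x := :- x) refl (γ v) ⟩
        - γ v                                   ∎
      from-γ : ∀ π {x y} → π ⟨$⟩ʳ x ≡ u → γ x ≡ γ v * y → fF R u v w π ≡ y → f π ≡ c * fF R u v w π
      from-γ π {x} {y} e γx fF≡ = *-cancelˡ (⟦suc⟧≢0 (suc k)) (begin
        ⟦ n ⟧ * f π                ≡⟨ trans (value π e) γx ⟩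
        γ v * y                    ≡⟨ cong₂ _*_ Nc fF≡ ⟨
        ⟦ n ⟧ * c * fF R u v w π   ≡⟨ *-assoc _ _ _ ⟩
        ⟦ n ⟧ * (c * fF R u v w π) ∎)
      by-position : ∀ π → Dec (π ⟨$⟩ʳ v ≡ u) → Dec (π ⟨$⟩ʳ w ≡ u) → f π ≡ c * fF R u v w π
      by-position π (yes e) _       = from-γ π e (sym (*-identityʳ _)) (fF-first π e)
      by-position π (no ne) (yes e) = from-γ π e
        (trans γw≡-γv (trans (cong -_ (sym (*-identityʳ (γ v)))) (solve 2 (λ x y → :- (x :* y) := x :* :- y) refl (γ v) 1r)))
        (fF-second π ne e)
      by-position π (no ne) (no ne′) = from-γ π (inverseʳ π)
        (trans (others (π ⟨$⟩ˡ u) (λ { refl → ne (inverseʳ π) }) (λ { refl → ne′ (inverseʳ π) })) (sym (zeroʳ _)))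
        (fF-neither π ne ne′)
      formula : ∀ π → f π ≡ c * fF R u v w π
      formula π = by-position π (π ⟨$⟩ʳ v Fin.≟ u) (π ⟨$⟩ʳ w Fin.≟ u)

    multiple-or-strict : IsMultipleOfF R (suc k) f ⊎ Strict
    multiple-or-strict = second (any? (λ w → ¬? (w Fin.≟ v) ×-dec ¬? (γ w ≟ 0r)))
      where
      v = proj₁ first
      γv = proj₂ first
      third : ∀ {w} → w ≢ v → ¬ γ w ≡ 0r → Dec (∃ λ z → z ≢ v × z ≢ w × ¬ γ z ≡ 0r) → IsMultipleOfF R (suc k) f ⊎ Strict
      third w≢v γw (yes (z , z≢v , z≢w , γz)) = inj₂ (three-rows (w≢v ∘ sym) z≢v z≢w γv γw γz)
      third w≢v γw (no none) = inj₁ (two-rows (inverse ⟦ n ⟧ (⟦suc⟧≢0 (suc k))) (w≢v ∘ sym) γv γw λ z z≢v z≢w →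
        decidable-stable (γ z ≟ 0r) λ γz → none (z , z≢v , z≢w , γz))
      second : Dec (∃ λ w → w ≢ v × ¬ γ w ≡ 0r) → IsMultipleOfF R (suc k) f ⊎ Strict
      second (no none) = contradiction (rest-zero λ w w≢v → decidable-stable (γ w ≟ 0r) λ γw → none (w , w≢v , γw)) γv
      second (yes (w , w≢v , γw)) = third w≢v γw
        (any? (λ z → ¬? (z Fin.≟ v) ×-dec ¬? (z Fin.≟ w) ×-dec ¬? (γ z ≟ 0r)))

  -- The dichotomy for `n` at least 8.

  module Large {l : ℕ} {f : Sym (8 ℕ.+ l) → ℝ} (f-resp : Resp f) (A : Matrix f) (f-nonzero : ∃ λ π → ¬ f π ≡ 0r) where

    k : ℕ
    k = 6 ℕ.+ l

    open Matrix A
    open Support f-resp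
    open Cases {k} f-resp A

    strict-of-pairs : ∀ {v w} → v ≢ w → 4 ℕ.* suc k ℕ.< U.pairs v w → Strict
    strict-of-pairs v≢w lt = strict-from-pairs k (k !) (ℕ.1≤n! k) lt (pairs-bound v≢w)

    -- Doubling the support, `4 * suc k * k !` must be exceeded. Two exceptional columns for `v`,
    -- `w` give `4 * k * k !`, and the second pair of rows adds more than the missing `4 * k !`.
    strict-of-union : ∀ {v w x y a b} → v ≢ w → x ≢ v → x ≢ w → y ≢ v → y ≢ w →
      U.differing v w a ≡ 2 → ¬ entry x b ≡ entry y b → Strict
    strict-of-union {v} {w} {x} {y} {a} {b} v≢w x≢v x≢w y≢v y≢w two ne =
      strict-from-union l (k !) {∑ₚ c₁} {∑ₚ c₀} {∑ₚ c₂} {outside v} {outside w} {card} (ℕ.1≤n! k)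
        (ℕ.≤-trans (ℕ.*-monoʳ-≤ (k !) (differing-pairs v w {s = k} two (ℕ.+-comm k 2))) (ℕ.≤-reflexive (sym (∑ₚ-differ v w v≢w))))
        (ℕ.≤-trans (ℕ.*-monoʳ-≤ (k !) (nonconstant-pairs x y (proj₂ varies))) (ℕ.≤-reflexive (sym (∑ₚ-differ x y x≢y))))
        (outside≤ (x≢v ∘ sym) (y≢v ∘ sym)) (outside≤ (x≢w ∘ sym) (y≢w ∘ sym)) c₀-cover union-bound
      where
      x≢y : x ≢ y
      x≢y refl = ne refl
      open Union {v} {w} {x} {y} {a} v≢w x≢y x≢v x≢w y≢v y≢w
      -- Both rows have sum zero, so rows that differ somewhere cannot differ by a constant.
      varies : ∃ λ b′ → ¬ diff x y b ≡ diff x y b′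
      varies = nonconstant (diff x y)
        (trans (sum-minus (entry x) (entry y)) (trans (cong₂ _-_ (row-sum x) (row-sum y)) (-‿inverseʳ 0r)))
        (ne ∘ x-y≡0⇒x≡y)
      outside≤ : ∀ {z} → z ≢ x → z ≢ y → n ℕ.* outside z ℕ.≤ outside z ℕ.+ (outside z ℕ.+ ∑ₚ c₀ ℕ.* 2)
      outside≤ {z} z≢x z≢y = subst (λ r → n ℕ.* outside z ℕ.≤ outside z ℕ.+ (outside z ℕ.+ ∑ₚ c₀ ℕ.* r)) two (outside-bound z≢x z≢y)

    differing-cong : ∀ v w v′ w′ {a} → (∀ c → diff v w a ≡ diff v w c → diff v′ w′ a ≡ diff v′ w′ c) →
      (∀ c → diff v′ w′ a ≡ diff v′ w′ c → diff v w a ≡ diff v w c) → U.differing v w a ≡ U.differing v′ w′ a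
    differing-cong v w v′ w′ {a} to from = ∑.sum-cong-≗ λ c →
      𝟙-cong (¬? (diff v w a ≟ diff v w c)) (¬? (diff v′ w′ a ≟ diff v′ w′ c)) (_∘ from c) (_∘ to c)

    differing-constant : ∀ v w {a} → (∀ c → diff v w a ≡ diff v w c) → U.differing v w a ≡ 0
    differing-constant v w {a} h = trans
      (∑.sum-cong-≗ λ c → 𝟙-no (¬? (diff v w a ≟ diff v w c)) (contradiction (h c)))
      (trans (∑-const n 0) (ℕ.*-zeroʳ n))

    EqualOutside : Fin n → Fin n → Set
    EqualOutside v w = ∀ {x y} → x ≢ v → x ≢ w → y ≢ v → y ≢ w → ∀ b → entry x b ≡ entry y b

    -- Row `zero` is among the equal rows, so all of them vanish and row `w` is the negative of row
    -- `v` by the column sums. Every permutation whose values at `v`, `w` are separated then lies in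
    -- the support, without passing to a swap.
    module BothNonzero {v w a : Fin n} (v≢w : v ≢ w) (v≢0 : v ≢ zero) (w≢0 : w ≢ zero) (two : U.differing v w a ≡ 2) (equal : EqualOutside v w) where

      rest-zero : ∀ {x} b → x ≢ v → x ≢ w → entry x b ≡ 0r
      rest-zero b x≢v x≢w = trans (equal x≢v x≢w (v≢0 ∘ sym) (w≢0 ∘ sym) b) (row-zero b)

      two-terms : ∀ (c : Fin n → Fin n) → sum (λ i → entry i (c i)) ≡ 0r → entry v (c v) + entry w (c w) ≡ 0r
      two-terms c Σ≡0 = begin
        entry v (c v) + entry w (c w)                          ≡⟨ cong (_+ entry w (c w)) (+-identityˡ _) ⟨
        0r + entry v (c v) + entry w (c w)                     ≡⟨ cong (λ s → s + entry v (c v) + entry w (c w)) (sum-zero {n} (λ _ → 0r) (λ _ → refl)) ⟨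
        sum {n} (λ _ → 0r) + entry v (c v) + entry w (c w)     ≡⟨ sum-change-two {g = λ i → entry i (c i)} {λ _ → 0r} v w v≢w (λ i i≢v i≢w → rest-zero (c i) i≢v i≢w) ⟨
        sum (λ i → entry i (c i)) + 0r + 0r                    ≡⟨ trans (+-identityʳ _) (trans (+-identityʳ _) Σ≡0) ⟩
        0r                                                     ∎
        where open ≡-Reasoning

      zero⇒agree : ∀ π → f π ≡ 0r → diff v w (π ⟨$⟩ʳ v) ≡ diff v w (π ⟨$⟩ʳ w)
      zero⇒agree π e = x-y≡0⇒x≡y (begin
        p - q - (r - z)                      ≡⟨ solve 4 (λ p q r s → p :- q :- (r :- s) := (p :+ s) :+ (p :+ s) :- (p :+ q) :- (r :+ s)) refl p q r z ⟩
        (p + z) + (p + z) - (p + q) - (r + z)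
          ≡⟨ cong₂ _-_ (cong₂ (λ x y → x + x - y) (two-terms (π ⟨$⟩ʳ_) (expand≡0 {π} e)) (two-terms (λ _ → π ⟨$⟩ʳ v) (col-sum _))) (two-terms (λ _ → π ⟨$⟩ʳ w) (col-sum _)) ⟩
        0r + 0r - 0r - 0r                    ≡⟨ solve 0 (con (ℤ.+ 0) :+ con (ℤ.+ 0) :- con (ℤ.+ 0) :- con (ℤ.+ 0) := con (ℤ.+ 0)) refl ⟩
        0r                                   ∎)
        where
        open ≡-Reasoning
        p = entry v (π ⟨$⟩ʳ v)
        q = entry w (π ⟨$⟩ʳ v)
        r = entry v (π ⟨$⟩ʳ w)
        z = entry w (π ⟨$⟩ʳ w)

      strict : Strict
      strict = strict-from-cover l (k !) {U.pairs v w} (ℕ.1≤n! k) (differing-pairs v w {s = k} two (ℕ.+-comm k 2))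
        (ℕ.≤-trans (ℕ.≤-reflexive (sym (∑ₚ-differ v w v≢w)))
          (∑ₚ-mono λ π → 𝟙-mono (¬? (diff v w (π ⟨$⟩ʳ v) ≟ diff v w (π ⟨$⟩ʳ w))) (S? π) (λ ne e → ne (zero⇒agree π e))))

    -- All rows outside {0, w} equal ρ, so row w is -kρ; the pairs (0, x) and (w, y) of rows satisfy strict-of-union.
    module OneZero {w a : Fin n} (w≢0 : w ≢ zero) (two : U.differing zero w a ≡ 2) (equal : EqualOutside zero w) where

      fresh-x : ∃ λ x → x ≢ zero × x ≢ w × x ≢ w
      fresh-x = fresh₃ (ℕ.m≤m+n 4 (4 ℕ.+ l)) zero w w
      x = proj₁ fresh-x
      x≢0 = proj₁ (proj₂ fresh-x)
      x≢w = proj₁ (proj₂ (proj₂ fresh-x))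
      fresh-y : ∃ λ y → y ≢ zero × y ≢ w × y ≢ x
      fresh-y = fresh₃ (ℕ.m≤m+n 4 (4 ℕ.+ l)) zero w x
      y = proj₁ fresh-y
      y≢0 = proj₁ (proj₂ fresh-y)
      y≢w = proj₁ (proj₂ (proj₂ fresh-y))
      y≢x = proj₂ (proj₂ (proj₂ fresh-y))

      ρ : Fin n → ℝ
      ρ = entry x

      K : ℝ
      K = ⟦ k ⟧

      row-w : ∀ b → entry w b + K * ρ b ≡ 0r
      row-w b = begin
        entry w b + K * ρ b
          ≡⟨ solve 3 (λ e Kρ ρ → e :+ Kρ := (ρ :+ (ρ :+ Kρ)) :+ con (ℤ.+ 0) :+ e :- ρ :- ρ) refl (entry w b) (K * ρ b) (ρ b) ⟩
        (ρ b + (ρ b + K * ρ b)) + 0r + entry w b - ρ b - ρ b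
          ≡⟨ cong (λ s → s + 0r + entry w b - ρ b - ρ b) nρ ⟨
        sum {n} (λ _ → ρ b) + 0r + entry w b - ρ b - ρ b
          ≡⟨ cong (λ z → sum {n} (λ _ → ρ b) + z + entry w b - ρ b - ρ b) (row-zero b) ⟨
        sum {n} (λ _ → ρ b) + entry zero b + entry w b - ρ b - ρ b
          ≡⟨ cong (λ s → s - ρ b - ρ b) (sum-change-two {g = λ i → entry i b} {λ _ → ρ b} zero w (w≢0 ∘ sym) (λ i i≢0 i≢w → equal i≢0 i≢w x≢0 x≢w b)) ⟨
        sum (λ i → entry i b) + ρ b + ρ b - ρ b - ρ b
          ≡⟨ cong (λ s → s + ρ b + ρ b - ρ b - ρ b) (col-sum b) ⟩
        0r + ρ b + ρ b - ρ b - ρ b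
          ≡⟨ solve 1 (λ ρ → con (ℤ.+ 0) :+ ρ :+ ρ :- ρ :- ρ := con (ℤ.+ 0)) refl (ρ b) ⟩
        0r ∎
        where
        open ≡-Reasoning
        suc* : ∀ i z → ⟦ suc i ⟧ * z ≡ z + ⟦ i ⟧ * z
        suc* i z = trans (distribʳ z 1r ⟦ i ⟧) (cong (_+ ⟦ i ⟧ * z) (*-identityˡ z))
        nρ : sum {n} (λ _ → ρ b) ≡ ρ b + (ρ b + K * ρ b)
        nρ = trans (sum-const n (ρ b)) (trans (suc* (suc k) (ρ b)) (cong (ρ b +_) (suc* k (ρ b))))

      diff-w : ∀ b → diff zero w b ≡ K * ρ b
      diff-w b = begin
        entry zero b - entry w b                    ≡⟨ cong (_- entry w b) (row-zero b) ⟩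
        0r - entry w b                              ≡⟨ solve 2 (λ e Kρ → con (ℤ.+ 0) :- e := Kρ :- (e :+ Kρ)) refl (entry w b) (K * ρ b) ⟩
        K * ρ b - (entry w b + K * ρ b)             ≡⟨ cong (λ z → K * ρ b - z) (row-w b) ⟩
        K * ρ b - 0r                                ≡⟨ solve 1 (λ z → z :- con (ℤ.+ 0) := z) refl (K * ρ b) ⟩
        K * ρ b                                     ∎
        where open ≡-Reasoning

      diff-x : ∀ b → diff zero x b ≡ - ρ b
      diff-x b = trans (cong (_- ρ b) (row-zero b)) (+-identityˡ _)

      -- `diff zero w` is `K * ρ` and `diff zero x` is `- ρ`; both have the level sets of `ρ`,
      -- because `K` is nonzero.
      two-x : U.differing zero x a ≡ 2
      two-x = trans (differing-cong zero x zero w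
        (λ c e → trans (diff-w a) (trans (cong (K *_) (neg-injective (trans (sym (diff-x a)) (trans e (diff-x c))))) (sym (diff-w c))))
        (λ c e → trans (diff-x a) (trans (cong -_ (*-cancelˡ (⟦suc⟧≢0 (5 ℕ.+ l)) (trans (sym (diff-w a)) (trans e (diff-w c))))) (sym (diff-x c)))))
        two
        where
        neg-injective : ∀ {p q} → - p ≡ - q → p ≡ q
        neg-injective {p} {q} e = trans (sym (solve 1 (λ p → :- (:- p) := p) refl p)) (trans (cong -_ e) (solve 1 (λ p → :- (:- p) := p) refl q))

      -- If rows `w` and `y` agreed, then `ρ = - K * ρ`, so `ρ` and with it `diff zero w` would
      -- vanish, against the two exceptional columns.
      rows-vary : Dec (∃ λ b → ¬ entry w b ≡ entry y b) → ∃ λ b → ¬ entry w b ≡ entry y b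
      rows-vary (yes r) = r
      rows-vary (no none) = contradiction (trans (sym two) (differing-constant zero w λ c → trans (vanish a) (sym (vanish c)))) λ ()
        where
        open ≡-Reasoning
        ρ≡0 : ∀ b → ρ b ≡ 0r
        ρ≡0 b = *-cancel-0 (⟦suc⟧≢0 k) (begin
          ⟦ suc k ⟧ * ρ b          ≡⟨ distribʳ (ρ b) 1r K ⟩
          1r * ρ b + K * ρ b       ≡⟨ cong (_+ K * ρ b) (*-identityˡ (ρ b)) ⟩
          ρ b + K * ρ b            ≡⟨ cong (_+ K * ρ b) (equal x≢0 x≢w y≢0 y≢w b) ⟩
          entry y b + K * ρ b      ≡⟨ cong (_+ K * ρ b) (decidable-stable (entry w b ≟ entry y b) (λ ne → none (b , ne))) ⟨
          entry w b + K * ρ b      ≡⟨ row-w b ⟩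
          0r                       ∎)
        vanish : ∀ b → diff zero w b ≡ 0r
        vanish b = trans (diff-w b) (trans (cong (K *_) (ρ≡0 b)) (zeroʳ K))

      strict : Strict
      strict = strict-of-union (x≢0 ∘ sym) w≢0 (x≢w ∘ sym) y≢0 y≢x two-x
        (proj₂ (rows-vary (any? (λ b → ¬? (entry w b ≟ entry y b)))))

    module TwoExceptional {v w a : Fin n} (v≢w : v ≢ w) (two : U.differing v w a ≡ 2) where

      Witness : Fin n → Fin n → Set
      Witness x y = x ≢ v × x ≢ w × y ≢ v × y ≢ w × ∃ λ b → ¬ entry x b ≡ entry y b

      witness? : ∀ x y → Dec (Witness x y)
      witness? x y = ¬? (x Fin.≟ v) ×-dec ¬? (x Fin.≟ w) ×-dec ¬? (y Fin.≟ v) ×-dec ¬? (y Fin.≟ w) ×-dec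
        any? (λ b → ¬? (entry x b ≟ entry y b))

      -- `OneZero` has row `zero` in the first place; if it is the second, the rows are exchanged,
      -- and the sign change of `diff` keeps the level sets.
      equal-rest : EqualOutside v w → Dec (v ≡ zero) → Dec (w ≡ zero) → Strict
      equal-rest equal (yes refl) _          = OneZero.strict (v≢w ∘ sym) two equal
      equal-rest equal (no v≢0)   (yes refl) = OneZero.strict v≢w
        (trans (differing-cong zero v v zero (λ c → flip-diff zero v) (λ c → flip-diff v zero)) two)
        (λ x≢0 x≢v y≢0 y≢v → equal x≢v x≢0 y≢v y≢0)
        where
        flip-diff : ∀ p q {c} → diff p q a ≡ diff p q c → diff q p a ≡ diff q p c
        flip-diff p q {c} e = trans (negate q p a) (trans (cong -_ e) (sym (negate q p c)))
          where
          negate : ∀ p q b → diff p q b ≡ - diff q p b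
          negate p q b = solve 2 (λ s t → s :- t := :- (t :- s)) refl (entry p b) (entry q b)
      equal-rest equal (no v≢0)   (no w≢0)   = BothNonzero.strict v≢w v≢0 w≢0 two equal

      search : Dec (∃ λ x → ∃ λ y → Witness x y) → Strict
      search (yes (x , y , x≢v , x≢w , y≢v , y≢w , b , ne)) = strict-of-union v≢w x≢v x≢w y≢v y≢w two ne
      search (no none) = equal-rest (λ {x} {y} x≢v x≢w y≢v y≢w b → decidable-stable (entry x b ≟ entry y b)
          λ ne → none (x , y , x≢v , x≢w , y≢v , y≢w , b , ne))
        (v Fin.≟ zero) (w Fin.≟ zero)

      strict : Strict
      strict = search (any? λ x → any? λ y → witness? x y)

    module ManyExceptional {v w : Fin n} (many : ¬ ∃ λ a → U.differing v w a ℕ.≤ 1) where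

      v≢w : v ≢ w
      v≢w refl = many (zero , ℕ.≤-trans (ℕ.≤-reflexive (differing-constant v v {zero} λ c → trans (-‿inverseʳ _) (sym (-‿inverseʳ _)))) z≤n)

      -- `many` excludes the counts 0 and 1. A count of 3 already gives enough pairs; if 2 and 3 do
      -- not occur, every count is at least 4.
      at-least-three : ¬ (∃ λ a → U.differing v w a ≡ 2) → Dec (∃ λ a → U.differing v w a ≡ 3) → Strict
      at-least-three _ (yes (a , three)) = strict-of-pairs v≢w
        (ℕ.<-≤-trans (4·7+<6·5+ l) (differing-pairs v w {s = 5 ℕ.+ l} three (ℕ.+-comm (5 ℕ.+ l) 3)))
      at-least-three ¬2 (no ¬3) = strict-of-pairs v≢w (ℕ.<-≤-trans (4·7+<8+·4 l) (U.pairs-≥-min v w 4 λ a →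
        ℕ.≤∧≢⇒< (ℕ.≤∧≢⇒< (ℕ.≰⇒> λ le → many (a , le)) (λ e → ¬2 (a , sym e))) (λ e → ¬3 (a , sym e))))

      at-least-two : Dec (∃ λ a → U.differing v w a ≡ 2) → Strict
      at-least-two (yes (a , two)) = TwoExceptional.strict v≢w two
      at-least-two (no ¬2) = at-least-three ¬2 (any? λ a → U.differing v w a ℕ.≟ 3)

      strict : Strict
      strict = at-least-two (any? λ a → U.differing v w a ℕ.≟ 2)

    module FewExceptional (few : ∀ v w → ∃ λ a → U.differing v w a ℕ.≤ 1) where

      column : Fin n → Fin n → Fin n
      column v w = proj₁ (U.almost-constant v w (proj₂ (few v w)))

      diff-off : ∀ v w {b b′} → b ≢ column v w → b′ ≢ column v w → diff v w b ≡ diff v w b′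
      diff-off v w {b} {b′} b≢ b′≢ = let h = proj₂ (U.almost-constant v w (proj₂ (few v w))) in trans (h b b≢) (sym (h b′ b′≢))

      diff-zero : ∀ v b → diff v zero b ≡ entry v b
      diff-zero v b = trans (cong (λ z → entry v b - z) (row-zero b)) (solve 1 (λ z → z :- con (ℤ.+ 0) := z) refl (entry v b))

      -- Row `zero` vanishes, so each row is a difference of two rows and has an exceptional column
      -- of its own.
      row-off : ∀ v {b b′} → b ≢ column v zero → b′ ≢ column v zero → entry v b ≡ entry v b′
      row-off v {b} {b′} b≢ b′≢ = trans (sym (diff-zero v b)) (trans (diff-off v zero b≢ b′≢) (diff-zero v b′))

      minus-injectiveˡ : ∀ {p q r} → p - r ≡ q - r → p ≡ q
      minus-injectiveˡ {p} {q} {r} e = trans (sym (undo p)) (trans (cong (_+ r) e) (undo q))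
        where
        undo : ∀ p → p - r + r ≡ p
        undo p = solve 2 (λ p r → p :- r :+ r := p) refl p r

      minus-injectiveʳ : ∀ {p q r} → p - q ≡ p - r → q ≡ r
      minus-injectiveʳ {p} {q} {r} e = trans (sym (undo q)) (trans (cong (λ z → p - z) e) (undo r))
        where
        undo : ∀ q → p - (p - q) ≡ q
        undo q = solve 2 (λ p q → p :- (p :- q) := q) refl p q

      module Column {v₀ c₀ c₁ : Fin n} (varies : ¬ entry v₀ c₀ ≡ entry v₀ c₁) where

        u : Fin n
        u = column v₀ zero

        not-constant : ∀ {c} → c ≢ u → ¬ entry v₀ u ≡ entry v₀ c
        not-constant {c} c≢u e = varies (trans (to-c c₀) (sym (to-c c₁)))
          where
          to-c : ∀ b → entry v₀ b ≡ entry v₀ c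
          to-c b with b Fin.≟ u
          ... | yes refl = e
          ... | no b≢u   = row-off v₀ b≢u c≢u

        -- All rows must share the exceptional column `u` of the nonconstant row `v₀`; the cases
        -- compare `u` with the exceptional columns of row `w` and of `diff v₀ w`.
        off-column : ∀ w → Dec (column w zero ≡ u) → Dec (column v₀ w ≡ u) → ∀ {b b′} → b ≢ u → b′ ≢ u → entry w b ≡ entry w b′
        off-column w (yes e) _ b≢u b′≢u = row-off w (λ e′ → b≢u (trans e′ e)) (λ e′ → b′≢u (trans e′ e))
        -- Between `u` and a column `c` avoiding all three exceptional columns, neither row `w` nor
        -- `diff v₀ w` changes; then row `v₀` does not change either, against `not-constant`.
        off-column w (no uw≢u) (no u′≢u) _ _ = contradiction (minus-injectiveˡ (begin
            entry v₀ u - entry w c    ≡⟨ cong (λ z → entry v₀ u - z) (row-off w (uw≢u ∘ sym) c≢uw) ⟨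
            diff v₀ w u               ≡⟨ diff-off v₀ w (u′≢u ∘ sym) c≢u′ ⟩
            entry v₀ c - entry w c    ∎)) (not-constant c≢u)
          where
          open ≡-Reasoning
          fresh = fresh₃ (ℕ.m≤m+n 4 (4 ℕ.+ l)) u (column w zero) (column v₀ w)
          c = proj₁ fresh
          c≢u = proj₁ (proj₂ fresh)
          c≢uw = proj₁ (proj₂ (proj₂ fresh))
          c≢u′ = proj₂ (proj₂ (proj₂ fresh))
        -- Row `v₀` and `diff v₀ w` can change at `u` only, so row `w` does not change at its own
        -- exceptional column `uw` and is constant.
        off-column w (no uw≢u) (yes u′≡u) {b} {b′} _ _ = trans (to-c b (b Fin.≟ uw)) (sym (to-c b′ (b′ Fin.≟ uw)))
          where
          open ≡-Reasoning
          uw = column w zero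
          fresh = fresh₃ (ℕ.m≤m+n 4 (4 ℕ.+ l)) u uw uw
          c = proj₁ fresh
          c≢u = proj₁ (proj₂ fresh)
          c≢uw = proj₁ (proj₂ (proj₂ fresh))
          at-uw : entry w uw ≡ entry w c
          at-uw = minus-injectiveʳ (begin
            entry v₀ uw - entry w uw  ≡⟨ diff-off v₀ w (λ e → uw≢u (trans e u′≡u)) (λ e → c≢u (trans e u′≡u)) ⟩
            entry v₀ c - entry w c    ≡⟨ cong (_- entry w c) (row-off v₀ c≢u uw≢u) ⟩
            entry v₀ uw - entry w c   ∎)
          to-c : ∀ b → Dec (b ≡ uw) → entry w b ≡ entry w c
          to-c b (yes refl) = at-uw
          to-c b (no b≢uw)  = row-off w b≢uw c≢uw

        conclusion : IsMultipleOfF R (suc k) f ⊎ Strict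
        conclusion = SingleColumn.multiple-or-strict {k} f-resp A f-nonzero u
          (λ w → off-column w (column w zero Fin.≟ u) (column v₀ w Fin.≟ u))

      nonzero-entry : Dec (∃ λ v → ∃ λ b → ¬ entry v b ≡ 0r) → IsMultipleOfF R (suc k) f ⊎ Strict
      nonzero-entry (yes (v , b , ne)) = Column.conclusion (proj₂ (nonconstant (entry v) (row-sum v) ne))
      nonzero-entry (no none) = contradiction (≡0-expand {proj₁ f-nonzero} (sum-zero _ λ v →
        decidable-stable (entry v (proj₁ f-nonzero ⟨$⟩ʳ v) ≟ 0r) λ ne → none (v , _ , ne))) (proj₂ f-nonzero)

      conclusion : IsMultipleOfF R (suc k) f ⊎ Strict
      conclusion = nonzero-entry (any? λ v → any? λ b → ¬? (entry v b ≟ 0r))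

    multiple-or-strict : IsMultipleOfF R (suc k) f ⊎ Strict
    multiple-or-strict = split (all? λ v → all? (few? v))
      where
      few? : ∀ v w → Dec (∃ λ a → U.differing v w a ℕ.≤ 1)
      few? v w = any? λ a → U.differing v w a ℕ.≤? 1
      split : Dec (∀ v w → ∃ λ a → U.differing v w a ℕ.≤ 1) → IsMultipleOfF R (suc k) f ⊎ Strict
      split (yes few) = FewExceptional.conclusion few
      split (no ¬few) =
        let v , ¬few-v = ¬∀⟶∃¬ n _ (λ v → all? (few? v)) ¬few
            w , many   = ¬∀⟶∃¬ n _ (few? v) ¬few-v
        in inj₂ (ManyExceptional.strict many)

  -- The dichotomy for `n = 3`.

  module Three {f : Sym 3 → ℝ} (f-resp : Resp f) (A : Matrix f) (f-nonzero : ∃ λ π → ¬ f π ≡ 0r) where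

    open Matrix A
    open Support f-resp
    open Cases {1} f-resp A using (n; Strict; expand≡0)
    module U = Unequal _≟_ (entry (suc zero))

    opposite : ∀ b → entry (suc (suc zero)) b ≡ - entry (suc zero) b
    opposite b = begin
      z                              ≡⟨ solve 2 (λ y z → z := (con (ℤ.+ 0) :+ (y :+ (z :+ con (ℤ.+ 0)))) :- y) refl y z ⟩
      (0r + (y + (z + 0r))) - y      ≡⟨ cong (λ x → (x + (y + (z + 0r))) - y) (row-zero b) ⟨
      sum (λ v → entry v b) - y      ≡⟨ cong (_- y) (col-sum b) ⟩
      0r - y                         ≡⟨ +-identityˡ (- y) ⟩
      - y                            ∎
      where
      open ≡-Reasoning
      y = entry (suc zero) b
      z = entry (suc (suc zero)) b

    -- The last two rows are opposite, so `3 * f π` is the difference of two entries of the middle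
    -- row.
    zero⇒equal : ∀ π → f π ≡ 0r → entry (suc zero) (π ⟨$⟩ʳ suc zero) ≡ entry (suc zero) (π ⟨$⟩ʳ suc (suc zero))
    zero⇒equal π e = x-y≡0⇒x≡y (begin
      y + - z                        ≡⟨ cong (y +_) (opposite (π ⟨$⟩ʳ suc (suc zero))) ⟨
      y + z′                         ≡⟨ solve 2 (λ y z → y :+ z := con (ℤ.+ 0) :+ (y :+ (z :+ con (ℤ.+ 0)))) refl y z′ ⟩
      0r + (y + (z′ + 0r))           ≡⟨ cong (_+ (y + (z′ + 0r))) (row-zero (π ⟨$⟩ʳ zero)) ⟨
      sum (λ v → entry v (π ⟨$⟩ʳ v)) ≡⟨ expand≡0 {π} e ⟩
      0r                             ∎)
      where
      open ≡-Reasoning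
      y = entry (suc zero) (π ⟨$⟩ʳ suc zero)
      z = entry (suc zero) (π ⟨$⟩ʳ suc (suc zero))
      z′ = entry (suc (suc zero)) (π ⟨$⟩ʳ suc (suc zero))

    off-column : ∀ {u} → (∀ {b b′} → b ≢ u → b′ ≢ u → entry (suc zero) b ≡ entry (suc zero) b′) →
      ∀ v {b b′} → b ≢ u → b′ ≢ u → entry v b ≡ entry v b′
    off-column h zero            _   _    = trans (row-zero _) (sym (row-zero _))
    off-column h (suc zero)      b≢u b′≢u = h b≢u b′≢u
    off-column h (suc (suc zero)) b≢u b′≢u = trans (opposite _) (trans (cong -_ (h b≢u b′≢u)) (sym (opposite _)))

    -- Two equal entries among three leave at most one differing from them.
    injective : (¬ ∃ λ a → U.differing a ℕ.≤ 1) → ∀ {a b} → a ≢ b → ¬ entry (suc zero) a ≡ entry (suc zero) b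
    injective many {a} {b} a≢b e = many (a , ℕ.+-cancelˡ-≤ 2 _ _ (begin
      2 ℕ.+ U.differing a              ≤⟨ ℕ.+-monoˡ-≤ (U.differing a) two-agree ⟩
      U.agreeing a ℕ.+ U.differing a   ≡⟨ U.agreeing+differing a ⟩
      3                                ∎))
      where
      open ℕ.≤-Reasoning
      agree : ∀ c → Dec (entry (suc zero) a ≡ entry (suc zero) c)
      agree c = entry (suc zero) a ≟ entry (suc zero) c
      two-agree : 2 ℕ.≤ U.agreeing a
      two-agree = ℕ.≤-trans (ℕ.≤-reflexive (sym (cong₂ ℕ._+_ (𝟙-yes (agree a) refl) (𝟙-yes (agree b) e))))
        (two≤sum (λ c → 𝟙 (agree c)) a≢b)

    multiple-or-strict : IsMultipleOfF R 2 f ⊎ Strict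
    multiple-or-strict = split (any? λ a → U.differing a ℕ.≤? 1)
      where
      split : Dec (∃ λ a → U.differing a ℕ.≤ 1) → IsMultipleOfF R 2 f ⊎ Strict
      split (yes (a , le)) = let u , h = U.almost-constant le in
        SingleColumn.multiple-or-strict {1} f-resp A f-nonzero u (off-column λ b≢u b′≢u → trans (h _ b≢u) (sym (h _ b′≢u)))
      -- The middle row is injective, so all 6 permutations lie in the support, while the bound is
      -- 4.
      split (no many) = inj₂ (ℕ.≤-trans (ℕ.n≤1+n 5) (ℕ.≤-trans (ℕ.≤-reflexive (sym (∑ₚ-const 3 1)))
        (∑ₚ-mono λ π → ℕ.≤-reflexive (sym (𝟙-yes (S? π) λ e → injective many (λ e′ → 1≢2 (perm-injective π e′)) (zero⇒equal π e))))))
        where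
        1≢2 : ¬ suc zero ≡ suc (suc (zero {0}))
        1≢2 ()

  -- From the dichotomy to the statement about supports.

  module Characterisation {k : ℕ} (f : Sym (2 ℕ.+ k) → ℝ) (f-respects : Respects R f)
    (f-eigen : IsEigenfunction R (suc k) ⟦ k ⟧ f) where

    f-resp : Resp f
    f-resp π σ e = f-respects {π} {σ} e

    matrix : Matrix f
    matrix = Structure.matrix f-resp λ π → begin
      sum (λ j → f (starNeighbour π j))          ≡⟨ sumFin≡sum (λ j → f (starNeighbour π j)) ⟨
      sumFin R (λ j → f (starNeighbour π j))     ≡⟨ proj₂ f-eigen π ⟨
      ⟦ k ⟧ * f π                                ≡⟨ solve 2 (λ x y → x := y :+ x :- y) refl _ (f π) ⟩
      f π + ⟦ k ⟧ * f π - f π                    ≡⟨ cong (λ x → x + ⟦ k ⟧ * f π - f π) (*-identityˡ (f π)) ⟨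
      1r * f π + ⟦ k ⟧ * f π - f π               ≡⟨ cong (_- f π) (distribʳ (f π) 1r ⟦ k ⟧) ⟨
      ⟦ suc k ⟧ * f π - f π                      ∎
      where open ≡-Reasoning

    open Support f-resp

    conclusion : IsMultipleOfF R (suc k) f ⊎ 2 ℕ.* (suc k !) ℕ.< card →
      SuppAtLeast R f (2 ℕ.* (suc k !)) × (SuppSize R f (2 ℕ.* (suc k !)) ⇔ IsMultipleOfF R (suc k) f)
    conclusion r = at-least (enough r) , mk⇔ (to r) from
      where
      enough : IsMultipleOfF R (suc k) f ⊎ 2 ℕ.* (suc k !) ℕ.< card → 2 ℕ.* (suc k !) ℕ.≤ card
      enough (inj₁ mult) = ℕ.≤-reflexive (sym (Multiple.card-multiple f-resp mult))
      enough (inj₂ lt)   = ℕ.<⇒≤ lt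
      at-least : ∀ {c} → c ℕ.≤ card → SuppAtLeast R f c
      at-least {c} le = take c elements
        , trans (List.length-take c elements) (ℕ.m≤n⇒m⊓n≡m (ℕ.≤-trans le (ℕ.≤-reflexive (sym length-elements))))
        , AllPairs.take⁺ c elements-distinct
        , All.take⁺ c elements-satisfy
      to : IsMultipleOfF R (suc k) f ⊎ 2 ℕ.* (suc k !) ℕ.< card → SuppSize R f (2 ℕ.* (suc k !)) → IsMultipleOfF R (suc k) f
      to (inj₁ mult) _ = mult
      -- Every complete duplicate-free list of the support has length `card`, which is strictly
      -- larger.
      to (inj₂ lt) (L , len , distinct , complete) = contradiction (trans (sym len) (card-unique L distinct complete)) (ℕ.<⇒≢ lt)
      from : IsMultipleOfF R (suc k) f → SuppSize R f (2 ℕ.* (suc k !))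
      from mult = elements , trans length-elements (Multiple.card-multiple f-resp mult) , elements-distinct , ∈-elements

open import Data.Nat using (ℕ; suc; _≤_; _∸_; _*_; _!)
open import Data.Nat.Properties using (m≤n⇒∃[o]m+o≡n)
open import Data.Sum using (_⊎_; inj₁; inj₂)
open import Data.Product using (_×_; _,_; proj₁)
open import Relation.Binary.PropositionalEquality using (_≡_; refl)
open import Function.Bundles using (_⇔_)

theorem2 : (R : RealField) (m : ℕ) → 8 ≤ suc m ⊎ suc m ≡ 3 →
    (f : Sym (suc m) → RealField.ℝ R) → Respects R f →
    IsEigenfunction R m (fromℕ R (suc m ∸ 2)) f →
    SuppAtLeast R f (2 * (m !)) ×
    (SuppSize R f (2 * (m !)) ⇔ IsMultipleOfF R m f)
theorem2 R _ (inj₂ refl) f f-respects f-eigen = conclusion (Three.multiple-or-strict f-resp matrix (proj₁ f-eigen))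
  where
  open Eigenfunctions R
  open Characterisation {1} f f-respects f-eigen
-- Writing `suc m` as `8 + l` makes `suc m ∸ 2` compute to `6 + l`, the value of `k` below.
theorem2 R m (inj₁ 8≤n) f f-respects f-eigen with m≤n⇒∃[o]m+o≡n 8≤n
... | l , refl = conclusion (Large.multiple-or-strict f-resp matrix (proj₁ f-eigen))
  where
  open Eigenfunctions R
  open Characterisation f f-respects f-eigen
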